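{- Every $10$-tough (finite, simple, connected, nonempty) graph is resistance positive (RP).
   Context: All graphs are finite, simple and connected, with at least one vertex. For a graph $G$ and $S\subseteq V(G)$, let $c(G-S)$ be the number of connected components of $G-S$. The toughness of a noncomplete graph $G$ is $\tau(G):=\min\{|S|/c(G-S): S\subseteq V(G),\ c(G-S)>1\}$; complete graphs have infinite toughness. $G$ is $t$-tough if $\tau(G)\ge t$. Resistance curvature: let $G=(V,E)$ be a finite simple connected graph, $\mathcal T(G)$ its set of spanning trees, and $c=(c_e)_{e\in E}$ positive edge weights. The relative resistance of an edge $e$ is $$r_e(c):=\frac{\sum_{T\in\mathcal T(G),\, e\in T}\prod_{h\in T}c_h}{\sum_{T\in\mathcal T(G)}\prod_{h\in T}c_h}$$ (equivalently $c_e$ times the effective resistance between the ends of $e$), and the resistance curvature of a vertex $v$ is $p_v(c):=1-\frac12\sum_{e\ni v}r_e(c)$. $G$ is resistance positive (RP) if there exist positive edge weights $c$ with $p_v(c)>0$ for every $v\in V$. -}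

module Defs where

import Algebra.Construct.NaturalChoice.Min as Min
open import Level using (0ℓ)
open import Data.Bool.Properties using () renaming (_≟_ to _≟ᵇ_)
open import Data.Empty using (⊥)
open import Data.Fin using (Fin; toℕ; _<_)
open import Data.Fin.Properties using (_≟_; _<?_; any?; all?; toℕ<n; toℕ-injective; <-cmp; injective⇒≤)
open import Data.Fin.Subset using (Subset; inside; outside; _∈_; _∉_; ∣_∣; _-_)
  renaming (⊤ to full)
open import Data.Fin.Subset.Properties using (_∈?_; ∈⊤; x∈p⇒∣p-x∣<∣p∣; x∈p∧x≢y⇒x∈p-y)
open import Data.Integer using (+_)
open import Data.List using (List; []; _∷_; [_]; _++_; map; foldr; filter; length; lookup; allFin; cartesianProduct; deduplicate)
open import Data.List.Membership.Propositional using () renaming (_∈_ to _∈ˡ_)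
open import Data.List.Membership.Propositional.Properties
  using (∈-filter⁺; ∈-cartesianProduct⁺; ∈-allFin; ∈-map⁺; ∈-++⁺ˡ; ∈-++⁺ʳ)
open import Data.List.Relation.Unary.All using (All; []; _∷_)
open import Data.List.Relation.Unary.AllPairs using ([]; _∷_)
open import Data.List.Relation.Unary.Any using (here; there; index)
open import Data.List.Relation.Unary.Any.Properties using (lookup-index)
open import Data.List.Relation.Unary.Linked using (Linked; [-]; _∷_; linked?)
open import Data.List.Relation.Unary.Unique.DecPropositional using (unique?)
open import Data.List.Relation.Unary.Unique.Propositional using (Unique)
open import Data.Nat as ℕ using (ℕ; zero; suc; z≤n; s≤s)
import Data.Nat.Properties as ℕ
open import Data.Product using (Σ; ∃; _×_; _,_; proj₁; proj₂)
open import Data.Product.Properties using (≡-dec)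
open import Data.Rational as ℚ using (ℚ; 0ℚ; 1ℚ; ½)
import Data.Rational.Properties as ℚ
open import Data.Sum using (_⊎_; inj₁; inj₂)
open import Data.Vec using ([]; _∷_; tabulate)
import Data.Vec.Properties as Vec
open import Function using (_∘_)
open import Relation.Binary using (Rel; Symmetric; TotalOrder; Decidable; tri<; tri≈; tri>)
import Relation.Binary.Construct.Add.Supremum.NonStrict as Supremum
open import Relation.Binary.Construct.Closure.ReflexiveTransitive
  using (Star; ε; _◅_; _◅◅_; reverse; kleisliStar) renaming (map to mapStar)
open import Relation.Binary.PropositionalEquality
  using (_≡_; _≢_; refl; sym; trans; cong; cong₂; subst)
open import Relation.Nullary using (¬_; Dec; yes; no; does; contradiction)
open import Relation.Nullary.Construct.Add.Supremum using (_⁺; ⊤⁺) renaming ([_] to [_]⁺)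
open import Relation.Nullary.Decidable using (_×-dec_; _⊎-dec_; ¬?; map′)
import Relation.Unary as U

------------------------------------------------------------------------
-- Real numbers

-- Cauchy sequences of rationals. Two sequences may represent the same real,
-- but every predicate on reals used below respects that identification, so
-- the quotient is not needed.

IsCauchy : (ℕ → ℚ) → Set
IsCauchy x = ∀ δ → 0ℚ ℚ.< δ →
  Σ ℕ λ N → ∀ i j → N ℕ.≤ i → N ℕ.≤ j → ℚ.∣ x i ℚ.- x j ∣ ℚ.≤ δ

record ℝ : Set where
  constructor mkℝ
  field
    seq    : ℕ → ℚ
    cauchy : IsCauchy seq

open ℝ public

-- x > 0: a single positive rational bounds the tail from below (positivity
-- of the individual terms would not be enough).
Positive : ℝ → Set
Positive x = Σ ℚ λ δ → 0ℚ ℚ.< δ × Σ ℕ λ N → ∀ i → N ℕ.≤ i → δ ℚ.≤ seq x i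

private
  module Q = ℚ.≤-Reasoning
  open import Data.Rational.Solver using (module +-*-Solver)
  open +-*-Solver using (solve; _:+_; _:*_; _:-_; :-_; _:=_; con)

  0<½ : 0ℚ ℚ.< ½
  0<½ = ℚ.positive⁻¹ ½

  0<1 : 0ℚ ℚ.< 1ℚ
  0<1 = ℚ.positive⁻¹ 1ℚ

  *-pos : ∀ {p q} → 0ℚ ℚ.< p → 0ℚ ℚ.< q → 0ℚ ℚ.< p ℚ.* q
  *-pos {p} {q} 0<p 0<q =
    ℚ.positive⁻¹ (p ℚ.* q) {{ℚ.pos*pos⇒pos p {{ℚ.positive 0<p}} q {{ℚ.positive 0<q}}}}

  +-pos : ∀ {p q} → 0ℚ ℚ.< p → 0ℚ ℚ.< q → 0ℚ ℚ.< p ℚ.+ q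
  +-pos {p} {q} 0<p 0<q = subst (ℚ._< p ℚ.+ q) (ℚ.+-identityˡ 0ℚ) (ℚ.+-mono-< 0<p 0<q)

  *-mono-≤ : ∀ {p q r s} → 0ℚ ℚ.≤ r → 0ℚ ℚ.≤ q → p ℚ.≤ q → r ℚ.≤ s → p ℚ.* r ℚ.≤ q ℚ.* s
  *-mono-≤ {p} {q} {r} {s} 0≤r 0≤q p≤q r≤s =
    ℚ.≤-trans (ℚ.*-monoʳ-≤-nonNeg r {{ℚ.nonNegative 0≤r}} p≤q)
              (ℚ.*-monoˡ-≤-nonNeg q {{ℚ.nonNegative 0≤q}} r≤s)

  recip : ∀ q → 0ℚ ℚ.< q → Σ ℚ λ r → 0ℚ ℚ.< r × r ℚ.* q ≡ 1ℚ
  recip q 0<q = (ℚ.1/ q) {{nz}} , ℚ.positive⁻¹ _ {{ℚ.1/pos⇒pos q {{ℚ.positive 0<q}}}} , ℚ.*-inverseˡ q {{nz}}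
    where nz = ℚ.>-nonZero 0<q

  halves : ∀ δ → ½ ℚ.* δ ℚ.+ ½ ℚ.* δ ≡ δ
  halves = solve 1 (λ d → con ½ :* d :+ con ½ :* d := d) refl

  const-cauchy : ∀ q → IsCauchy (λ _ → q)
  const-cauchy q δ 0<δ = 0 , λ _ _ _ _ →
    subst (ℚ._≤ δ) (sym (cong ℚ.∣_∣ (ℚ.+-inverseʳ q))) (ℚ.<⇒≤ 0<δ)

  +-cauchy : ∀ {x y} → IsCauchy x → IsCauchy y → IsCauchy (λ i → x i ℚ.+ y i)
  +-cauchy {x} {y} cx cy δ 0<δ
    with M , hx ← cx (½ ℚ.* δ) (*-pos 0<½ 0<δ)
       | N , hy ← cy (½ ℚ.* δ) (*-pos 0<½ 0<δ)
    = M ℕ.⊔ N , λ i j Mi Mj → Q.begin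
      ℚ.∣ (x i ℚ.+ y i) ℚ.- (x j ℚ.+ y j) ∣
        Q.≡⟨ cong ℚ.∣_∣ (solve 4 (λ a b c d → (a :+ b) :- (c :+ d) := (a :- c) :+ (b :- d)) refl (x i) (y i) (x j) (y j)) ⟩
      ℚ.∣ (x i ℚ.- x j) ℚ.+ (y i ℚ.- y j) ∣
        Q.≤⟨ ℚ.∣p+q∣≤∣p∣+∣q∣ (x i ℚ.- x j) (y i ℚ.- y j) ⟩
      ℚ.∣ x i ℚ.- x j ∣ ℚ.+ ℚ.∣ y i ℚ.- y j ∣
        Q.≤⟨ ℚ.+-mono-≤ (hx i j (ℕ.m⊔n≤o⇒m≤o M N Mi) (ℕ.m⊔n≤o⇒m≤o M N Mj))
                        (hy i j (ℕ.m⊔n≤o⇒n≤o M N Mi) (ℕ.m⊔n≤o⇒n≤o M N Mj)) ⟩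
      ½ ℚ.* δ ℚ.+ ½ ℚ.* δ
        Q.≡⟨ halves δ ⟩
      δ Q.∎

  neg-cauchy : ∀ {x} → IsCauchy x → IsCauchy (λ i → ℚ.- x i)
  neg-cauchy {x} cx δ 0<δ with N , hx ← cx δ 0<δ = N , λ i j Ni Nj →
    subst (ℚ._≤ δ) (cong ℚ.∣_∣ (solve 2 (λ a b → b :- a := (:- a) :- (:- b)) refl (x i) (x j))) (hx j i Nj Ni)

  Bounded : (ℕ → ℚ) → Set
  Bounded x = Σ ℚ λ B → 0ℚ ℚ.< B × Σ ℕ λ N → ∀ i → N ℕ.≤ i → ℚ.∣ x i ∣ ℚ.≤ B

  bound : ∀ {x} → IsCauchy x → Bounded x
  bound {x} cx with N , hx ← cx 1ℚ 0<1
    = 1ℚ ℚ.+ ℚ.∣ x N ∣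
    , ℚ.<-≤-trans 0<1 (subst (ℚ._≤ 1ℚ ℚ.+ ℚ.∣ x N ∣) (ℚ.+-identityʳ 1ℚ) (ℚ.+-monoʳ-≤ 1ℚ (ℚ.0≤∣p∣ (x N))))
    , N
    , λ i Ni → Q.begin
      ℚ.∣ x i ∣
        Q.≡⟨ cong ℚ.∣_∣ (solve 2 (λ a b → a := (a :- b) :+ b) refl (x i) (x N)) ⟩
      ℚ.∣ (x i ℚ.- x N) ℚ.+ x N ∣
        Q.≤⟨ ℚ.∣p+q∣≤∣p∣+∣q∣ (x i ℚ.- x N) (x N) ⟩
      ℚ.∣ x i ℚ.- x N ∣ ℚ.+ ℚ.∣ x N ∣
        Q.≤⟨ ℚ.+-monoˡ-≤ ℚ.∣ x N ∣ (hx i N Ni ℕ.≤-refl) ⟩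
      1ℚ ℚ.+ ℚ.∣ x N ∣ Q.∎

  product-step : ∀ a b c d → a ℚ.* b ℚ.- c ℚ.* d ≡ (a ℚ.- c) ℚ.* d ℚ.+ (b ℚ.- d) ℚ.* a
  product-step = solve 4 (λ a b c d → a :* b :- c :* d := (a :- c) :* d :+ (b :- d) :* a) refl

  product-close : ∀ {A A′ B B′ δ} a b c d → 0ℚ ℚ.< A′ → 0ℚ ℚ.< B′ → A′ ℚ.* A ≡ 1ℚ → B′ ℚ.* B ≡ 1ℚ → 0ℚ ℚ.< δ →
    ℚ.∣ a ∣ ℚ.≤ A → ℚ.∣ d ∣ ℚ.≤ B → ℚ.∣ a ℚ.- c ∣ ℚ.≤ δ ℚ.* B′ → ℚ.∣ b ℚ.- d ∣ ℚ.≤ δ ℚ.* A′ →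
    ℚ.∣ a ℚ.* b ℚ.- c ℚ.* d ∣ ℚ.≤ δ ℚ.+ δ
  product-close {A} {A′} {B} {B′} {δ} a b c d 0<A′ 0<B′ A′A B′B 0<δ a≤A d≤B ac bd = Q.begin
      ℚ.∣ a ℚ.* b ℚ.- c ℚ.* d ∣
        Q.≡⟨ cong ℚ.∣_∣ (product-step a b c d) ⟩
      ℚ.∣ (a ℚ.- c) ℚ.* d ℚ.+ (b ℚ.- d) ℚ.* a ∣
        Q.≤⟨ ℚ.∣p+q∣≤∣p∣+∣q∣ ((a ℚ.- c) ℚ.* d) ((b ℚ.- d) ℚ.* a) ⟩
      ℚ.∣ (a ℚ.- c) ℚ.* d ∣ ℚ.+ ℚ.∣ (b ℚ.- d) ℚ.* a ∣
        Q.≡⟨ cong₂ ℚ._+_ (ℚ.∣p*q∣≡∣p∣*∣q∣ (a ℚ.- c) d) (ℚ.∣p*q∣≡∣p∣*∣q∣ (b ℚ.- d) a) ⟩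
      ℚ.∣ a ℚ.- c ∣ ℚ.* ℚ.∣ d ∣ ℚ.+ ℚ.∣ b ℚ.- d ∣ ℚ.* ℚ.∣ a ∣
        Q.≤⟨ ℚ.+-mono-≤
               (*-mono-≤ {ℚ.∣ a ℚ.- c ∣} {δ ℚ.* B′} {ℚ.∣ d ∣} {B} (ℚ.0≤∣p∣ d) (ℚ.<⇒≤ (*-pos 0<δ 0<B′)) ac d≤B)
               (*-mono-≤ {ℚ.∣ b ℚ.- d ∣} {δ ℚ.* A′} {ℚ.∣ a ∣} {A} (ℚ.0≤∣p∣ a) (ℚ.<⇒≤ (*-pos 0<δ 0<A′)) bd a≤A) ⟩
      δ ℚ.* B′ ℚ.* B ℚ.+ δ ℚ.* A′ ℚ.* A
        Q.≡⟨ cong₂ ℚ._+_ (cancel B′ B B′B) (cancel A′ A A′A) ⟩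
      δ ℚ.+ δ Q.∎
    where
    cancel : ∀ e′ e → e′ ℚ.* e ≡ 1ℚ → δ ℚ.* e′ ℚ.* e ≡ δ
    cancel e′ e eq = trans (ℚ.*-assoc δ e′ e) (trans (cong (δ ℚ.*_) eq) (ℚ.*-identityʳ δ))

  *-cauchy : ∀ {x y} → IsCauchy x → IsCauchy y → IsCauchy (λ i → x i ℚ.* y i)
  *-cauchy {x} {y} cx cy δ 0<δ = go (bound {x} cx) (bound {y} cy)
    where
    go₂ : ∀ {A A′ B B′ η} → 0ℚ ℚ.< A′ → 0ℚ ℚ.< B′ → A′ ℚ.* A ≡ 1ℚ → B′ ℚ.* B ≡ 1ℚ →
      0ℚ ℚ.< η → η ℚ.+ η ≡ δ → ∀ M N K L →
      (∀ i → M ℕ.≤ i → ℚ.∣ x i ∣ ℚ.≤ A) → (∀ i → N ℕ.≤ i → ℚ.∣ y i ∣ ℚ.≤ B) →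
      (∀ i j → K ℕ.≤ i → K ℕ.≤ j → ℚ.∣ x i ℚ.- x j ∣ ℚ.≤ η ℚ.* B′) →
      (∀ i j → L ℕ.≤ i → L ℕ.≤ j → ℚ.∣ y i ℚ.- y j ∣ ℚ.≤ η ℚ.* A′) →
      ∀ i j → (M ℕ.⊔ N) ℕ.⊔ (K ℕ.⊔ L) ℕ.≤ i → (M ℕ.⊔ N) ℕ.⊔ (K ℕ.⊔ L) ℕ.≤ j →
      ℚ.∣ x i ℚ.* y i ℚ.- x j ℚ.* y j ∣ ℚ.≤ δ
    go₂ {A} {A′} {B} {B′} {η} 0<A′ 0<B′ A′A B′B 0<η ηη M N K L hA hB hx hy i j i≥ j≥ =
      subst (ℚ.∣ x i ℚ.* y i ℚ.- x j ℚ.* y j ∣ ℚ.≤_) ηη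
        (product-close {A} {A′} {B} {B′} {η} (x i) (y i) (x j) (y j) 0<A′ 0<B′ A′A B′B 0<η
          (hA i (ℕ.m⊔n≤o⇒m≤o M N (left i≥)))
          (hB j (ℕ.m⊔n≤o⇒n≤o M N (left j≥)))
          (hx i j (ℕ.m⊔n≤o⇒m≤o K L (right i≥)) (ℕ.m⊔n≤o⇒m≤o K L (right j≥)))
          (hy i j (ℕ.m⊔n≤o⇒n≤o K L (right i≥)) (ℕ.m⊔n≤o⇒n≤o K L (right j≥))))
      where
      left : ∀ {i} → (M ℕ.⊔ N) ℕ.⊔ (K ℕ.⊔ L) ℕ.≤ i → M ℕ.⊔ N ℕ.≤ i
      left = ℕ.m⊔n≤o⇒m≤o (M ℕ.⊔ N) (K ℕ.⊔ L)
      right : ∀ {i} → (M ℕ.⊔ N) ℕ.⊔ (K ℕ.⊔ L) ℕ.≤ i → K ℕ.⊔ L ℕ.≤ i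
      right = ℕ.m⊔n≤o⇒n≤o (M ℕ.⊔ N) (K ℕ.⊔ L)

    go : Bounded x → Bounded y → Σ ℕ λ N → ∀ i j → N ℕ.≤ i → N ℕ.≤ j → ℚ.∣ x i ℚ.* y i ℚ.- x j ℚ.* y j ∣ ℚ.≤ δ
    go (A , 0<A , M , hA) (B , 0<B , N , hB) =
      (M ℕ.⊔ N) ℕ.⊔ (proj₁ hx ℕ.⊔ proj₁ hy) ,
      go₂ {A} {proj₁ rA} {B} {proj₁ rB} {η} (proj₁ (proj₂ rA)) (proj₁ (proj₂ rB)) (proj₂ (proj₂ rA)) (proj₂ (proj₂ rB))
        0<η (halves δ) M N (proj₁ hx) (proj₁ hy) hA hB (proj₂ hx) (proj₂ hy)
      where
      η = ½ ℚ.* δ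
      0<η = *-pos {½} {δ} 0<½ 0<δ
      rA = recip A 0<A
      rB = recip B 0<B
      hx = cx (η ℚ.* proj₁ rB) (*-pos {η} {proj₁ rB} 0<η (proj₁ (proj₂ rB)))
      hy = cy (η ℚ.* proj₁ rA) (*-pos {η} {proj₁ rA} 0<η (proj₁ (proj₂ rA)))

-- The value at 0 is irrelevant: a positive Cauchy sequence is eventually
-- bounded away from 0.
recipℚ : ℚ → ℚ
recipℚ q with q ℚ.≟ 0ℚ
... | yes _   = 0ℚ
... | no  q≢0 = (ℚ.1/ q) {{ℚ.≢-nonZero q≢0}}

private
  recipℚ-inverse : ∀ q → 0ℚ ℚ.< q → recipℚ q ℚ.* q ≡ 1ℚ
  recipℚ-inverse q 0<q with q ℚ.≟ 0ℚ
  ... | yes q≡0 = contradiction (sym q≡0) (ℚ.<⇒≢ 0<q)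
  ... | no  q≢0 = ℚ.*-inverseˡ q {{ℚ.≢-nonZero q≢0}}

  recip-cauchy : ∀ x → Positive x → IsCauchy (λ i → recipℚ (seq x i))
  recip-cauchy (mkℝ x cx) (c , 0<c , M , hc) δ 0<δ
    with N , hx ← cx (δ ℚ.* (c ℚ.* c)) (*-pos 0<δ (*-pos 0<c 0<c))
    = M ℕ.⊔ N , λ i j i≥ j≥ →
      close (x i) (x j) (hc i (ℕ.m⊔n≤o⇒m≤o M N i≥)) (hc j (ℕ.m⊔n≤o⇒m≤o M N j≥))
            (hx j i (ℕ.m⊔n≤o⇒n≤o M N j≥) (ℕ.m⊔n≤o⇒n≤o M N i≥))
    where
    close : ∀ a b → c ℚ.≤ a → c ℚ.≤ b → ℚ.∣ b ℚ.- a ∣ ℚ.≤ δ ℚ.* (c ℚ.* c) →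
            ℚ.∣ recipℚ a ℚ.- recipℚ b ∣ ℚ.≤ δ
    close a b c≤a c≤b h = ℚ.*-cancelʳ-≤-pos (a ℚ.* b) {{ℚ.positive 0<ab}} (Q.begin
      ℚ.∣ a′ ℚ.- b′ ∣ ℚ.* (a ℚ.* b)
        Q.≡⟨ cong (ℚ.∣ a′ ℚ.- b′ ∣ ℚ.*_) (sym (ℚ.0≤p⇒∣p∣≡p (ℚ.<⇒≤ 0<ab))) ⟩
      ℚ.∣ a′ ℚ.- b′ ∣ ℚ.* ℚ.∣ a ℚ.* b ∣
        Q.≡⟨ sym (ℚ.∣p*q∣≡∣p∣*∣q∣ (a′ ℚ.- b′) (a ℚ.* b)) ⟩
      ℚ.∣ (a′ ℚ.- b′) ℚ.* (a ℚ.* b) ∣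
        Q.≡⟨ cong ℚ.∣_∣ (solve 4 (λ a a′ b b′ → (a′ :- b′) :* (a :* b) := (a′ :* a) :* b :- (b′ :* b) :* a) refl a a′ b b′) ⟩
      ℚ.∣ (a′ ℚ.* a) ℚ.* b ℚ.- (b′ ℚ.* b) ℚ.* a ∣
        Q.≡⟨ cong ℚ.∣_∣ (cong₂ (λ s t → s ℚ.* b ℚ.- t ℚ.* a) (recipℚ-inverse a 0<a) (recipℚ-inverse b 0<b)) ⟩
      ℚ.∣ 1ℚ ℚ.* b ℚ.- 1ℚ ℚ.* a ∣
        Q.≡⟨ cong ℚ.∣_∣ (cong₂ ℚ._-_ (ℚ.*-identityˡ b) (ℚ.*-identityˡ a)) ⟩
      ℚ.∣ b ℚ.- a ∣
        Q.≤⟨ h ⟩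
      δ ℚ.* (c ℚ.* c)
        Q.≤⟨ ℚ.*-monoˡ-≤-nonNeg δ {{ℚ.nonNegative (ℚ.<⇒≤ 0<δ)}}
               (*-mono-≤ (ℚ.<⇒≤ 0<c) (ℚ.<⇒≤ 0<a) c≤a c≤b) ⟩
      δ ℚ.* (a ℚ.* b) Q.∎)
      where
      a′ = recipℚ a
      b′ = recipℚ b
      0<a = ℚ.<-≤-trans 0<c c≤a
      0<b = ℚ.<-≤-trans 0<c c≤b
      0<ab = *-pos 0<a 0<b

fromℚ : ℚ → ℝ
fromℚ q = mkℝ (λ _ → q) (const-cauchy q)

0ℝ 1ℝ ½ℝ : ℝ
0ℝ = fromℚ 0ℚ
1ℝ = fromℚ 1ℚ
½ℝ = fromℚ ½

infixl 6 _+ᴿ_ _-ᴿ_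
infixl 7 _*ᴿ_ _/ᴿ_[_]

_+ᴿ_ : ℝ → ℝ → ℝ
x +ᴿ y = mkℝ (λ i → seq x i ℚ.+ seq y i) (+-cauchy {seq x} {seq y} (cauchy x) (cauchy y))

_-ᴿ_ : ℝ → ℝ → ℝ
x -ᴿ y = mkℝ (λ i → seq x i ℚ.- seq y i) 
  (+-cauchy {seq x} {λ i → ℚ.- seq y i} (cauchy x) (neg-cauchy {seq y} (cauchy y)))

_*ᴿ_ : ℝ → ℝ → ℝ
x *ᴿ y = mkℝ (λ i → seq x i ℚ.* seq y i) (*-cauchy {seq x} {seq y} (cauchy x) (cauchy y))

_/ᴿ_[_] : ℝ → (y : ℝ) → Positive y → ℝ
x /ᴿ y [ y>0 ] = x *ᴿ mkℝ (λ i → recipℚ (seq y i)) (recip-cauchy y y>0)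

∑ ∏ : {A : Set} → List A → (A → ℝ) → ℝ
∑ xs f = foldr (λ x s → f x +ᴿ s) 0ℝ xs
∏ xs f = foldr (λ x s → f x *ᴿ s) 1ℝ xs

+ᴿ-positive : ∀ x y → Positive x → Positive y → Positive (x +ᴿ y)
+ᴿ-positive x y (c , 0<c , M , hx) (d , 0<d , N , hy) =
  c ℚ.+ d , +-pos {c} {d} 0<c 0<d , M ℕ.⊔ N , λ i i≥ →
    ℚ.+-mono-≤ {c} {seq x i} {d} {seq y i}
      (hx i (ℕ.m⊔n≤o⇒m≤o M N i≥)) (hy i (ℕ.m⊔n≤o⇒n≤o M N i≥))

*ᴿ-positive : ∀ x y → Positive x → Positive y → Positive (x *ᴿ y)
*ᴿ-positive x y (c , 0<c , M , hx) (d , 0<d , N , hy) =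
  c ℚ.* d , *-pos {c} {d} 0<c 0<d , M ℕ.⊔ N , λ i i≥ →
    *-mono-≤ {c} {seq x i} {d} {seq y i}
      (ℚ.<⇒≤ 0<d) (ℚ.<⇒≤ (ℚ.<-≤-trans 0<c (hx i (ℕ.m⊔n≤o⇒m≤o M N i≥))))
      (hx i (ℕ.m⊔n≤o⇒m≤o M N i≥)) (hy i (ℕ.m⊔n≤o⇒n≤o M N i≥))

∏-positive : ∀ {A : Set} (xs : List A) f → (∀ x → Positive (f x)) → Positive (∏ xs f)
∏-positive []       f f>0 = 1ℚ , 0<1 , 0 , λ _ _ → ℚ.≤-refl
∏-positive (x ∷ xs) f f>0 = *ᴿ-positive (f x) (∏ xs f) (f>0 x) (∏-positive xs f f>0)

∑-positive : ∀ {A : Set} {x : A} {xs} f → x ∈ˡ xs → (∀ x → Positive (f x)) → Positive (∑ xs f)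
∑-positive {xs = x ∷ []} f _ f>0 with c , 0<c , N , h ← f>0 x =
  c , 0<c , N , λ i i≥ → subst (c ℚ.≤_) (sym (ℚ.+-identityʳ (seq (f x) i))) (h i i≥)
∑-positive {xs = x ∷ xs@(_ ∷ _)} f _ f>0 =
  +ᴿ-positive (f x) (∑ xs f) (f>0 x) (∑-positive {xs = xs} f (here refl) f>0)

------------------------------------------------------------------------
-- Reachability in finite relations

-- Decidability of Star by the Floyd–Warshall recursion: Via k u v means
-- that v is reachable from u with all intermediate vertices below k.
private
  module Reachability {n} {R : Rel (Fin n) 0ℓ} (R? : Decidable R) where

    Via : ℕ → Rel (Fin n) 0ℓ
    Via zero    u v = u ≡ v ⊎ R u v
    Via (suc k) u v = Via k u v ⊎ ∃ λ w → toℕ w ≡ k × Via k u w × Via k w v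

    via? : ∀ k → Decidable (Via k)
    via? zero    u v = (u ≟ v) ⊎-dec R? u v
    via? (suc k) u v = via? k u v ⊎-dec
      any? λ w → (toℕ w ℕ.≟ k) ×-dec via? k u w ×-dec via? k w v

    sound : ∀ k {u v} → Via k u v → Star R u v
    sound zero    (inj₁ refl)              = ε
    sound zero    (inj₂ r)                 = r ◅ ε
    sound (suc k) (inj₁ p)                 = sound k p
    sound (suc k) (inj₂ (_ , _ , p , q))   = sound k p ◅◅ sound k q

    lift : ∀ k {u v} → u ≡ v ⊎ R u v → Via k u v
    lift zero    p = p
    lift (suc k) p = inj₁ (lift k p)

    join : ∀ k {u w v} → toℕ w ℕ.< k → Via k u w → Via k w v → Via k u v
    join (suc k) {u} {w} {v} (s≤s w≤k) p q with ℕ.m≤n⇒m<n∨m≡n w≤k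
    ... | inj₂ w≡k = inj₂ (w , w≡k , toW p , fromW q)
      where
      toW : Via (suc k) u w → Via k u w
      toW (inj₁ p)                  = p
      toW (inj₂ (x , x≡k , p , _))  = subst (Via k u) (toℕ-injective (trans x≡k (sym w≡k))) p
      fromW : Via (suc k) w v → Via k w v
      fromW (inj₁ q)                = q
      fromW (inj₂ (x , x≡k , _ , q)) = subst (λ y → Via k y v) (toℕ-injective (trans x≡k (sym w≡k))) q
    ... | inj₁ w<k = cases p q
      where
      cases : Via (suc k) u w → Via (suc k) w v → Via (suc k) u v
      cases (inj₁ p) (inj₁ q)                       = inj₁ (join k w<k p q)
      cases (inj₁ p) (inj₂ (y , e , q , r))         = inj₂ (y , e , join k w<k p q , r)
      cases (inj₂ (x , e , o , p)) (inj₁ q)         = inj₂ (x , e , o , join k w<k p q)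
      cases (inj₂ (x , e , o , _)) (inj₂ (y , e′ , _ , r)) =
        inj₂ (x , e , o , subst (λ z → Via k z v) (toℕ-injective (trans e′ (sym e))) r)

    complete : ∀ {u v} → Star R u v → Via n u v
    complete ε        = lift n (inj₁ refl)
    complete (r ◅ rs) = join n (toℕ<n _) (lift n (inj₂ r)) (complete rs)

star? : ∀ {n} {R : Rel (Fin n) 0ℓ} → Decidable R → Decidable (Star R)
star? {n} R? u v = map′ (sound n) complete (via? n u v)
  where open Reachability R?

Connected : ∀ {n} → Rel (Fin n) 0ℓ → Set
Connected R = ∀ u v → Star R u v

connected? : ∀ {n} {R : Rel (Fin n) 0ℓ} → Decidable R → Dec (Connected R)
connected? R? = all? λ u → all? λ v → star? R? u v

------------------------------------------------------------------------
-- Cycles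

-- The vertex list v ∷ vs stands for the closed walk v, vs, v.
IsCycle : ∀ {n} → Rel (Fin n) 0ℓ → List (Fin n) → Set
IsCycle R []       = ⊥
IsCycle R (v ∷ vs) = 3 ℕ.≤ length (v ∷ vs) × Unique (v ∷ vs) × Linked R (v ∷ vs ++ [ v ])

Acyclic : ∀ {n} → Rel (Fin n) 0ℓ → Set
Acyclic R = ¬ ∃ (IsCycle R)

private
  isCycle? : ∀ {n} {R : Rel (Fin n) 0ℓ} → Decidable R → U.Decidable (IsCycle R)
  isCycle? R? []       = no λ ()
  isCycle? R? (v ∷ vs) =
    (3 ℕ.≤? length (v ∷ vs)) ×-dec unique? _≟_ (v ∷ vs) ×-dec linked? R? (v ∷ vs ++ [ v ])

  lookup-All : ∀ {A : Set} {P : A → Set} {xs} → All P xs → ∀ i → P (lookup xs i)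
  lookup-All (p ∷ _)  Fin.zero    = p
  lookup-All (_ ∷ ps) (Fin.suc i) = lookup-All ps i

  lookup-injective : ∀ {A : Set} {xs : List A} → Unique xs →
                     ∀ {i j} → lookup xs i ≡ lookup xs j → i ≡ j
  lookup-injective (_ ∷ _)  {Fin.zero}  {Fin.zero}  _ = refl
  lookup-injective (x∉ ∷ _) {Fin.zero}  {Fin.suc j} e = contradiction e (lookup-All x∉ j)
  lookup-injective (x∉ ∷ _) {Fin.suc i} {Fin.zero}  e = contradiction (sym e) (lookup-All x∉ i)
  lookup-injective (_ ∷ u)  {Fin.suc i} {Fin.suc j} e = cong Fin.suc (lookup-injective u e)

  cycle-length : ∀ {n} {R : Rel (Fin n) 0ℓ} xs → IsCycle R xs → length xs ℕ.≤ n
  cycle-length (_ ∷ _) (_ , u , _) = injective⇒≤ (lookup-injective u)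

  anyList? : ∀ {n} k {P : List (Fin n) → Set} → U.Decidable P →
             Dec (∃ λ xs → length xs ℕ.≤ k × P xs)
  anyList? zero    P? = map′ (λ p → [] , z≤n , p) (λ { ([] , _ , p) → p }) (P? [])
  anyList? (suc k) P? = map′
    (λ { (inj₁ p) → [] , z≤n , p ; (inj₂ (x , xs , l , p)) → x ∷ xs , s≤s l , p })
    (λ { ([] , _ , p) → inj₁ p ; (x ∷ xs , s≤s l , p) → inj₂ (x , xs , l , p) })
    (P? [] ⊎-dec any? λ x → anyList? k (P? ∘ (x ∷_)))

  cycle? : ∀ {n} {R : Rel (Fin n) 0ℓ} → Decidable R → Dec (∃ (IsCycle R))
  cycle? {n} R? = map′ (λ (xs , _ , c) → xs , c) (λ (xs , c) → xs , cycle-length xs c , c)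
    (anyList? n (isCycle? R?))

------------------------------------------------------------------------
-- Graphs

record Graph (n : ℕ) : Set₁ where
  infix 4 _~_ _~?_
  field
    _~_      : Rel (Fin n) 0ℓ
    _~?_     : Decidable _~_
    ~-sym    : Symmetric _~_
    ~-irrefl : ∀ v → ¬ v ~ v

subsets : ∀ n → List (Subset n)
subsets zero    = [ [] ]
subsets (suc n) = map (inside ∷_) (subsets n) ++ map (outside ∷_) (subsets n)

subsets-complete : ∀ {n} (S : Subset n) → S ∈ˡ subsets n
subsets-complete []            = here refl
subsets-complete (inside  ∷ S) = ∈-++⁺ˡ (∈-map⁺ (inside ∷_) (subsets-complete S))
subsets-complete {suc n} (outside ∷ S) =
  ∈-++⁺ʳ (map (inside ∷_) (subsets n)) (∈-map⁺ (outside ∷_) (subsets-complete S))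

module _ {n} (G : Graph n) where
  open Graph G

  ConnectedGraph : Set
  ConnectedGraph = Connected _~_

  ----------------------------------------------------------------------
  -- Toughness

  -- Adjacency in G − S.
  Deleted : Subset n → Rel (Fin n) 0ℓ
  Deleted S u v = u ∉ S × v ∉ S × u ~ v

  deleted? : ∀ S → Decidable (Deleted S)
  deleted? S u v = ¬? (u ∈? S) ×-dec ¬? (v ∈? S) ×-dec (u ~? v)

  component : Subset n → Fin n → Subset n
  component S v = tabulate λ w → does (star? (deleted? S) v w)

  -- The distinct vertex sets of components of G − S; S itself contributes
  -- nothing because only vertices outside S are used.
  components : Subset n → List (Subset n)
  components S = deduplicate (Vec.≡-dec _≟ᵇ_)
    (map (component S) (filter (λ v → ¬? (v ∈? S)) (allFin n)))

  numComponents : Subset n → ℕ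
  numComponents S = length (components S)

  -- |S| / c(G − S), or ∞ when c(G − S) ≤ 1, which removes S from the minimum.
  ratio : Subset n → ℚ ⁺
  ratio S with 1 ℕ.<? numComponents S
  ... | yes 1<c = [ (+ ∣ S ∣ ℚ./ numComponents S) {{ℕ.>-nonZero (ℕ.<-trans (s≤s z≤n) 1<c)}} ]⁺
  ... | no  _   = ⊤⁺

open Supremum ℚ._≤_ using (_≤⁺_; ≤⁺-isTotalOrder-≡)

ℚ⁺-totalOrder : TotalOrder 0ℓ 0ℓ 0ℓ
ℚ⁺-totalOrder = record { isTotalOrder = ≤⁺-isTotalOrder-≡ ℚ.≤-isTotalOrder }

open Min ℚ⁺-totalOrder using () renaming (_⊓_ to _⊓⁺_)

-- A complete graph has no S with c(G − S) > 1, so its toughness is ∞.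
toughness : ∀ {n} → Graph n → ℚ ⁺
toughness {n} G = foldr _⊓⁺_ ⊤⁺ (map (ratio G) (subsets n))

Tough : ∀ {n} → ℚ → Graph n → Set
Tough t G = [ t ]⁺ ≤⁺ toughness G

------------------------------------------------------------------------
-- Spanning trees

module _ {n} (G : Graph n) where
  open Graph G

  -- Each edge is listed once, with its smaller end first.
  edges : List (Fin n × Fin n)
  edges = filter (λ (u , v) → (u <? v) ×-dec (u ~? v)) (cartesianProduct (allFin n) (allFin n))

  Edge : Set
  Edge = Fin (length edges)

  EdgeSet : Set
  EdgeSet = Subset (length edges)

  ends : Edge → Fin n × Fin n
  ends = lookup edges

  Incident : Fin n → Edge → Set
  Incident v e = proj₁ (ends e) ≡ v ⊎ proj₂ (ends e) ≡ v

  incident? : ∀ v → U.Decidable (Incident v)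
  incident? v e = (proj₁ (ends e) ≟ v) ⊎-dec (proj₂ (ends e) ≟ v)

  Joins : Edge → Rel (Fin n) 0ℓ
  Joins e u v = ends e ≡ (u , v) ⊎ ends e ≡ (v , u)

  -- Adjacency in the spanning subgraph (V , T).
  Spanned : EdgeSet → Rel (Fin n) 0ℓ
  Spanned T u v = ∃ λ e → e ∈ T × Joins e u v

  spanned? : ∀ T → Decidable (Spanned T)
  spanned? T u v = any? λ e →
    (e ∈? T) ×-dec (≡-dec _≟_ _≟_ (ends e) (u , v) ⊎-dec ≡-dec _≟_ _≟_ (ends e) (v , u))

  IsSpanningTree : EdgeSet → Set
  IsSpanningTree T = Connected (Spanned T) × Acyclic (Spanned T)

  isSpanningTree? : U.Decidable IsSpanningTree
  isSpanningTree? T = connected? (spanned? T) ×-dec ¬? (cycle? (spanned? T))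

  spanningTrees : List EdgeSet
  spanningTrees = filter isSpanningTree? (subsets (length edges))

  -- Existence of a spanning tree: starting from all edges, remove
  -- an edge of some cycle for as long as there is one.
  private
    spanned-sym : ∀ T → Symmetric (Spanned T)
    spanned-sym T (e , e∈T , inj₁ p) = e , e∈T , inj₂ p
    spanned-sym T (e , e∈T , inj₂ p) = e , e∈T , inj₁ p

    edge : ∀ {u v} → u ~ v → Spanned full u v
    edge {u} {v} u~v with <-cmp u v
    ... | tri< u<v _ _ = index mem , ∈⊤ , inj₁ (sym (lookup-index mem))
      where mem = ∈-filter⁺ (λ (u , v) → (u <? v) ×-dec (u ~? v))
                    (∈-cartesianProduct⁺ (∈-allFin u) (∈-allFin v)) (u<v , u~v)
    ... | tri≈ _ refl _ = contradiction u~v (~-irrefl u)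
    ... | tri> _ _ v<u = index mem , ∈⊤ , inj₂ (sym (lookup-index mem))
      where mem = ∈-filter⁺ (λ (u , v) → (u <? v) ×-dec (u ~? v))
                    (∈-cartesianProduct⁺ (∈-allFin v) (∈-allFin u)) (v<u , ~-sym u~v)

    same-ends : ∀ {e u v a b} → Joins e u v → Joins e a b → (u ≡ a × v ≡ b) ⊎ (u ≡ b × v ≡ a)
    same-ends (inj₁ p) (inj₁ q) with refl ← trans (sym p) q = inj₁ (refl , refl)
    same-ends (inj₁ p) (inj₂ q) with refl ← trans (sym p) q = inj₂ (refl , refl)
    same-ends (inj₂ p) (inj₁ q) with refl ← trans (sym p) q = inj₂ (refl , refl)
    same-ends (inj₂ p) (inj₂ q) with refl ← trans (sym p) q = inj₁ (refl , refl)

    module _ (T : EdgeSet) {e v x} (e∈T : e ∈ T) (evx : Joins e v x) where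

      keep : ∀ {a b} y → y ≡ v ⊎ y ≡ x → y ≢ a → y ≢ b → Spanned T a b → Spanned (T - e) a b
      keep {a} {b} y y∈ y≢a y≢b (f , f∈T , fab) = f , x∈p∧x≢y⇒x∈p-y f∈T f≢e , fab
        where
        fresh : y ≡ v ⊎ y ≡ x → (v ≡ a × x ≡ b) ⊎ (v ≡ b × x ≡ a) → ⊥
        fresh (inj₁ refl) (inj₁ (p , _)) = y≢a p
        fresh (inj₁ refl) (inj₂ (p , _)) = y≢b p
        fresh (inj₂ refl) (inj₁ (_ , p)) = y≢b p
        fresh (inj₂ refl) (inj₂ (_ , p)) = y≢a p

        f≢e : f ≢ e
        f≢e f≡e = fresh y∈ (same-ends {e} evx (subst (λ g → Joins g a b) f≡e fab))

      walk : ∀ a as → x ≢ v → All (x ≢_) (a ∷ as) → Linked (Spanned T) (a ∷ as ++ [ v ]) →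
             Star (Spanned (T - e)) a v
      walk a []       x≢v (x≢a ∷ [])        (l ∷ [-]) = keep x (inj₂ refl) x≢a x≢v l ◅ ε
      walk a (b ∷ bs) x≢v (x≢a ∷ x≢b ∷ x∉)  (l ∷ ls)  =
        keep x (inj₂ refl) x≢a x≢b l ◅ walk b bs x≢v (x≢b ∷ x∉) ls

    removeCycleEdge : ∀ T → Connected (Spanned T) → ∃ (IsCycle (Spanned T)) →
                      ∃ λ e → e ∈ T × Connected (Spanned (T - e))
    removeCycleEdge T conn (v ∷ [] , s≤s () , _)
    removeCycleEdge T conn (v ∷ x ∷ [] , s≤s (s≤s ()) , _)
    removeCycleEdge T conn
      (v ∷ x ∷ y ∷ zs , _ , (v≢x ∷ v≢y ∷ _) ∷ (x∉@(_ ∷ _)) ∷ _ , (e , e∈T , evx) ∷ xy ∷ ls) =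
      e , e∈T , λ a b → kleisliStar (λ u → u) step (conn a b)
      where
      detour : Star (Spanned (T - e)) x v
      detour = keep T e∈T evx v (inj₁ refl) v≢x v≢y xy ◅
               walk T e∈T evx y zs (v≢x ∘ sym) x∉ ls

      step : ∀ {a b} → Spanned T a b → Star (Spanned (T - e)) a b
      step (f , f∈T , fab) with f ≟ e
      ... | no f≢e = (f , x∈p∧x≢y⇒x∈p-y f∈T f≢e , fab) ◅ ε
      ... | yes refl with same-ends {e} evx fab
      ...   | inj₁ (refl , refl) = reverse (spanned-sym (T - e)) detour
      ...   | inj₂ (refl , refl) = detour

    prune : ∀ k T → ∣ T ∣ ℕ.≤ k → Connected (Spanned T) → ∃ IsSpanningTree
    prune k T T≤k conn with cycle? (spanned? T)
    ... | no  acyclic = T , conn , acyclic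
    ... | yes cycle with removeCycleEdge T conn cycle
    ...   | e , e∈T , conn′ with k | ℕ.<-≤-trans (x∈p⇒∣p-x∣<∣p∣ e∈T) T≤k
    ...     | suc k | s≤s T-e≤k = prune k (T - e) T-e≤k conn′

  spanningTree-exists : ConnectedGraph G → ∃ λ T → T ∈ˡ spanningTrees
  spanningTree-exists conn
    with T , tree ← prune _ full ℕ.≤-refl (λ u v → mapStar edge (conn u v))
    = T , ∈-filter⁺ isSpanningTree? (subsets-complete T) tree

------------------------------------------------------------------------
-- Resistance curvature

  treeWeight : (Edge → ℝ) → EdgeSet → ℝ
  treeWeight w T = ∏ (filter (_∈? T) (allFin (length edges))) w

  treeSum : (Edge → ℝ) → ℝ
  treeSum w = ∑ spanningTrees (treeWeight w)

  treeSumThrough : (Edge → ℝ) → Edge → ℝ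
  treeSumThrough w e = ∑ (filter (e ∈?_) spanningTrees) (treeWeight w)

  PositiveWeights : (Edge → ℝ) → Set
  PositiveWeights w = ∀ e → Positive (w e)

  treeSum-positive : ConnectedGraph G → ∀ w → PositiveWeights w → Positive (treeSum w)
  treeSum-positive conn w w>0 =
    ∑-positive (treeWeight w) (proj₂ (spanningTree-exists conn))
      λ T → ∏-positive (filter (_∈? T) (allFin (length edges))) w w>0

  module _ (conn : ConnectedGraph G) (w : Edge → ℝ) (w>0 : PositiveWeights w) where

    relativeResistance : Edge → ℝ
    relativeResistance e = treeSumThrough w e /ᴿ treeSum w [ treeSum-positive conn w w>0 ]

    curvature : Fin n → ℝ
    curvature v = 1ℝ -ᴿ ½ℝ *ᴿ ∑ (filter (incident? v) (allFin (length edges))) relativeResistance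

  ResistancePositive : ConnectedGraph G → Set
  ResistancePositive conn =
    Σ (Edge → ℝ) λ w → Σ (PositiveWeights w) λ w>0 → ∀ v → Positive (curvature conn w w>0 v)

{-# OPTIONS --safe #-}
-- Give each edge the weight g^k with 0 < g < 1, where k counts its ends in a list h of
-- vertices. Spanning trees are then weighted by g^cost, where cost is the sum of the
-- degrees of the members of h. As long as a vertex has expected degree at least 2 it is
-- appended to h; this process stops because every h admits a spanning tree of cost at
-- most (2 - 1/n)|h|. At its end all expected degrees are below 2, that is, all
-- curvatures are positive.
--
-- To find the cheap tree, let y v be the multiplicity of v in h and order the edges
-- lexicographically by the larger, then the smaller value of y at their ends. Let S be the
-- set of vertices with y > s and U its complement, with c components in G[U]. Kruskal's
-- tree T induces c components on U, and every vertex of N(U) has a T-edge into U, so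
--   ∑_{v ∈ S} deg v = 2(|S| - 1 + c) - e_T(S, U) ≤ 2(|S| - 1 + c) - |N(U)| < 2|S|,
-- since 2-toughness gives |N(U)| ≥ 2c when c > 1. Sum over all levels s.
module Submission where

open import Defs
open import Data.Nat using (ℕ; NonZero)
open import Data.Integer using (+_)
open import Data.Rational using (_/_)

open import Algebra.Bundles using (CommutativeRing)
import Algebra.Construct.NaturalChoice.Min as Min
import Algebra.Construct.NaturalChoice.MinOp as MinOp
open import Data.Bool.Properties using () renaming (_≟_ to _≟ᵇ_)
open import Data.Fin using (Fin; zero; suc; toℕ)
open import Data.Fin.Properties using (_≟_; <-cmp; any?; all?; ¬∀⟶∃¬)
open import Data.Fin.Subset using (Subset; _∈_; _∉_; ∣_∣)
open import Data.Fin.Subset.Properties using (_∈?_)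
import Data.Integer as ℤ
import Data.Integer.Properties as ℤ
open import Data.List using (List; []; _∷_; map; foldr; filter; length; allFin; cartesianProduct; downFrom)
open import Data.List.Membership.Propositional using () renaming (_∈_ to _∈ˡ_)
open import Data.List.Membership.Propositional.Properties
  using (∈-filter⁺; ∈-filter⁻; ∈-cartesianProduct⁺; ∈-allFin; ∈-lookup; ∈-map⁺; ∈-deduplicate⁺)
open import Data.List.Properties using (map-tabulate; map-∘; map-cong; length-filter; length-tabulate)
import Data.List.Relation.Unary.Linked as Linked
open import Data.List.Relation.Unary.Any using (here; there; index)
open import Data.List.Relation.Unary.Any.Properties using (lookup-index)
open import Data.Nat as ℕ using (zero; suc; z≤n; s≤s)
open import Data.Nat.ListAction using (sum)
import Data.Nat.Properties as ℕ
open import Data.Product using (Σ; ∃; _×_; _,_; proj₁; proj₂)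
open import Data.Product.Properties using (≡-dec)
open import Data.Rational as ℚ using (ℚ; 0ℚ; 1ℚ; ½)
import Data.Rational.Properties as ℚ
open import Data.Rational.Unnormalised as ℚᵘ using (mkℚᵘ)
import Data.Rational.Unnormalised.Properties as ℚᵘ
open import Data.Sum using (inj₁; inj₂)
open import Data.Vec as Vec using (tabulate)
import Data.Vec.Properties as VecP
open import Function using (_∘_)
open import Relation.Binary using (tri<; tri≈; tri>)
open import Relation.Binary.Construct.Add.Supremum.NonStrict ℚ._≤_ using (_≤⁺_; [_])
open import Relation.Binary.Construct.Closure.ReflexiveTransitive
  using (Star; ε; _◅_; _◅◅_; reverse) renaming (map to mapStar)
open import Relation.Binary.PropositionalEquality
open import Relation.Nullary using (¬_; Dec; yes; no; does; contradiction)
open import Relation.Nullary.Construct.Add.Supremum using (⊤⁺) renaming ([_] to [_]⁺)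
open import Relation.Nullary.Decidable using (_×-dec_; _⊎-dec_; ¬?; dec-true; from-yes)
import Relation.Unary as U

-- Estimates for rational powers, and the multiplicative-weights process.

module Rational where

  open import Data.Rational using (_≤_; _<_; _+_; _*_; _-_)
  open import Data.Rational.Solver using (module +-*-Solver)
  open +-*-Solver using (solve; _:+_; _:*_; _:-_; _:=_; con)

  private
    ℚ-semiring = CommutativeRing.semiring ℚ.+-*-commutativeRing

  open import Algebra.Properties.Semiring.Exp ℚ-semiring public using (_^_; ^-homo-*; ^-assocʳ)
  open import Algebra.Properties.Semiring.Mult ℚ-semiring using (×1-homo-*; ×-homo-+)
    renaming (_×_ to _·_)

  module Qr = ℚ.≤-Reasoning

  ∑ℚ : {A : Set} → List A → (A → ℚ) → ℚ
  ∑ℚ xs f = foldr (λ x s → f x + s) 0ℚ xs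

  ι : ℕ → ℚ
  ι k = k · 1ℚ

  0≤1 : 0ℚ ≤ 1ℚ
  0≤1 = ℚ.nonNegative⁻¹ 1ℚ

  0<½ : 0ℚ < ½
  0<½ = ℚ.positive⁻¹ ½

  +-nonNeg : ∀ {p q} → 0ℚ ≤ p → 0ℚ ≤ q → 0ℚ ≤ p + q
  +-nonNeg {p} {q} 0≤p 0≤q = subst (_≤ p + q) (ℚ.+-identityˡ 0ℚ) (ℚ.+-mono-≤ 0≤p 0≤q)

  *-nonNeg : ∀ {p q} → 0ℚ ≤ p → 0ℚ ≤ q → 0ℚ ≤ p * q
  *-nonNeg {p} {q} 0≤p 0≤q =
    subst (_≤ p * q) (ℚ.*-zeroʳ p) (ℚ.*-monoˡ-≤-nonNeg p {{ℚ.nonNegative 0≤p}} 0≤q)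

  *-pos : ∀ {p q} → 0ℚ < p → 0ℚ < q → 0ℚ < p * q
  *-pos {p} {q} 0<p 0<q =
    ℚ.positive⁻¹ (p * q) {{ℚ.pos*pos⇒pos p {{ℚ.positive 0<p}} q {{ℚ.positive 0<q}}}}

  *-mono-≤-nonNeg : ∀ {p q r s} → 0ℚ ≤ r → 0ℚ ≤ q → p ≤ q → r ≤ s → p * r ≤ q * s
  *-mono-≤-nonNeg {p} {q} {r} {s} 0≤r 0≤q p≤q r≤s =
    ℚ.≤-trans (ℚ.*-monoʳ-≤-nonNeg r {{ℚ.nonNegative 0≤r}} p≤q)
              (ℚ.*-monoˡ-≤-nonNeg q {{ℚ.nonNegative 0≤q}} r≤s)

  p≤p+q : ∀ {p q} → 0ℚ ≤ q → p ≤ p + q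
  p≤p+q {p} {q} 0≤q = subst (_≤ p + q) (ℚ.+-identityʳ p) (ℚ.+-monoʳ-≤ p 0≤q)

  ≤-by : ∀ {p q} d → 0ℚ ≤ d → q ≡ p + d → p ≤ q
  ≤-by {p} d 0≤d eq = subst (p ≤_) (sym eq) (p≤p+q 0≤d)

  0≤q-p : ∀ {p q} → p ≤ q → 0ℚ ≤ q - p
  0≤q-p {p} {q} p≤q = subst (_≤ q - p) (ℚ.+-inverseʳ p) (ℚ.+-monoˡ-≤ (ℚ.- p) p≤q)

  reciprocal : ∀ q → 0ℚ < q → ∃ λ r → 0ℚ < r × q * r ≡ 1ℚ
  reciprocal q 0<q =
    (ℚ.1/ q) {{nz}} , ℚ.positive⁻¹ _ {{ℚ.1/pos⇒pos q {{ℚ.positive 0<q}}}} , ℚ.*-inverseʳ q {{nz}}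
    where nz = ℚ.>-nonZero 0<q

  0≤ι : ∀ k → 0ℚ ≤ ι k
  0≤ι zero    = ℚ.≤-refl
  0≤ι (suc k) = +-nonNeg 0≤1 (0≤ι k)

  0<ι-suc : ∀ k → 0ℚ < ι (suc k)
  0<ι-suc k = ℚ.<-≤-trans (ℚ.positive⁻¹ 1ℚ) (p≤p+q (0≤ι k))

  ι-mono-≤ : ∀ {j k} → j ℕ.≤ k → ι j ≤ ι k
  ι-mono-≤ {k = k} z≤n = 0≤ι k
  ι-mono-≤ (s≤s j≤k)   = ℚ.+-monoʳ-≤ 1ℚ (ι-mono-≤ j≤k)

  ^-pos : ∀ {g} → 0ℚ < g → ∀ k → 0ℚ < g ^ k
  ^-pos 0<g zero    = ℚ.positive⁻¹ 1ℚ
  ^-pos 0<g (suc k) = *-pos 0<g (^-pos 0<g k)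

  ^-≤1 : ∀ {g} → 0ℚ < g → g ≤ 1ℚ → ∀ k → g ^ k ≤ 1ℚ
  ^-≤1 0<g g≤1 zero    = ℚ.≤-refl
  ^-≤1 0<g g≤1 (suc k) = *-mono-≤-nonNeg (ℚ.<⇒≤ (^-pos 0<g k)) 0≤1 g≤1 (^-≤1 0<g g≤1 k)

  ^-antimono-≤ : ∀ {g} → 0ℚ < g → g ≤ 1ℚ → ∀ {j k} → j ℕ.≤ k → g ^ k ≤ g ^ j
  ^-antimono-≤ 0<g g≤1 {k = k} z≤n = ^-≤1 0<g g≤1 k
  ^-antimono-≤ {g} 0<g g≤1 (s≤s j≤k) =
    ℚ.*-monoˡ-≤-nonNeg g {{ℚ.nonNegative (ℚ.<⇒≤ 0<g)}} (^-antimono-≤ 0<g g≤1 j≤k)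

  bernoulli : ∀ {x} → 0ℚ ≤ x → ∀ k → 1ℚ + ι k * x ≤ (1ℚ + x) ^ k
  bernoulli {x} 0≤x zero = ℚ.≤-reflexive (solve 1 (λ x → con 1ℚ :+ con 0ℚ :* x := con 1ℚ) refl x)
  bernoulli {x} 0≤x (suc k) = Qr.begin
    1ℚ + (1ℚ + ι k) * x
      Qr.≤⟨ ≤-by (x * (ι k * x)) (*-nonNeg 0≤x (*-nonNeg (0≤ι k) 0≤x))
              (solve 2 (λ x k → (con 1ℚ :+ x) :* (con 1ℚ :+ k :* x)
                 := con 1ℚ :+ (con 1ℚ :+ k) :* x :+ x :* (k :* x)) refl x (ι k)) ⟩
    (1ℚ + x) * (1ℚ + ι k * x)
      Qr.≤⟨ ℚ.*-monoˡ-≤-nonNeg (1ℚ + x) {{ℚ.nonNegative (+-nonNeg 0≤1 0≤x)}} (bernoulli 0≤x k) ⟩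
    (1ℚ + x) * (1ℚ + x) ^ k Qr.∎

  module _ {x} (0≤x : 0ℚ ≤ x) (x≤1 : x ≤ 1ℚ) where

    1-x^-lower : ∀ k → 1ℚ - ι k * x ≤ (1ℚ - x) ^ k
    1-x^-lower zero = ℚ.≤-reflexive (solve 1 (λ x → con 1ℚ :- con 0ℚ :* x := con 1ℚ) refl x)
    1-x^-lower (suc k) = Qr.begin
      1ℚ - (1ℚ + ι k) * x
        Qr.≤⟨ ≤-by (x * (ι k * x)) (*-nonNeg 0≤x (*-nonNeg (0≤ι k) 0≤x))
                (solve 2 (λ x k → (con 1ℚ :- x) :* (con 1ℚ :- k :* x)
                   := con 1ℚ :- (con 1ℚ :+ k) :* x :+ x :* (k :* x)) refl x (ι k)) ⟩
      (1ℚ - x) * (1ℚ - ι k * x)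
        Qr.≤⟨ ℚ.*-monoˡ-≤-nonNeg (1ℚ - x) {{ℚ.nonNegative (0≤q-p x≤1)}} (1-x^-lower k) ⟩
      (1ℚ - x) * (1ℚ - x) ^ k Qr.∎

    -- The error term is quadratic in `ι k * x`, so for small `x` the power is linear in `k` up to a
    -- small fraction of `x`. This linearises the effect of a penalty on the weight of a tree.
    1-x^-upper : ∀ k → (1ℚ - x) ^ k ≤ 1ℚ - ι k * x + (ι k * x) * (ι k * x)
    1-x^-upper zero = ℚ.≤-reflexive
      (solve 1 (λ x → con 1ℚ := con 1ℚ :- con 0ℚ :* x :+ (con 0ℚ :* x) :* (con 0ℚ :* x)) refl x)
    1-x^-upper (suc k) = Qr.begin
      (1ℚ - x) * (1ℚ - x) ^ k
        Qr.≤⟨ ℚ.*-monoˡ-≤-nonNeg (1ℚ - x) {{ℚ.nonNegative (0≤q-p x≤1)}} (1-x^-upper k) ⟩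
      (1ℚ - x) * (1ℚ - y + y * y)
        Qr.≤⟨ ≤-by (x * x + y * x + x * (y * y))
                (+-nonNeg (+-nonNeg (*-nonNeg 0≤x 0≤x) (*-nonNeg 0≤y 0≤x)) (*-nonNeg 0≤x (*-nonNeg 0≤y 0≤y)))
                (solve 2 (λ x k → con 1ℚ :- (con 1ℚ :+ k) :* x :+ ((con 1ℚ :+ k) :* x) :* ((con 1ℚ :+ k) :* x)
                   := (con 1ℚ :- x) :* (con 1ℚ :- k :* x :+ (k :* x) :* (k :* x))
                      :+ (x :* x :+ (k :* x) :* x :+ x :* ((k :* x) :* (k :* x)))) refl x (ι k)) ⟩
      1ℚ - (1ℚ + ι k) * x + ((1ℚ + ι k) * x) * ((1ℚ + ι k) * x) Qr.∎
      where
      y = ι k * x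
      0≤y = *-nonNeg (0≤ι k) 0≤x

  ∑ℚ-nonNeg : ∀ {A : Set} (xs : List A) {f} → (∀ x → 0ℚ ≤ f x) → 0ℚ ≤ ∑ℚ xs f
  ∑ℚ-nonNeg []       0≤f = ℚ.≤-refl
  ∑ℚ-nonNeg (x ∷ xs) 0≤f = +-nonNeg (0≤f x) (∑ℚ-nonNeg xs 0≤f)

  ∑ℚ-term : ∀ {A : Set} {xs : List A} {f} → (∀ x → 0ℚ ≤ f x) → ∀ {x} → x ∈ˡ xs → f x ≤ ∑ℚ xs f
  ∑ℚ-term {xs = _ ∷ xs} 0≤f (here refl) = p≤p+q (∑ℚ-nonNeg xs 0≤f)
  ∑ℚ-term {xs = y ∷ xs} {f} 0≤f (there x∈) =
    ℚ.≤-trans (∑ℚ-term 0≤f x∈)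
      (subst (∑ℚ xs f ≤_) (ℚ.+-comm (∑ℚ xs f) (f y)) (p≤p+q (0≤f y)))

  ∑ℚ-1 : ∀ {A : Set} (xs : List A) → ∑ℚ xs (λ _ → 1ℚ) ≡ ι (length xs)
  ∑ℚ-1 []       = refl
  ∑ℚ-1 (_ ∷ xs) = cong (λ x → 1ℚ + x) (∑ℚ-1 xs)

  ∑ℚ-cong : ∀ {A : Set} (xs : List A) {f g} → (∀ x → f x ≡ g x) → ∑ℚ xs f ≡ ∑ℚ xs g
  ∑ℚ-cong []       f≡g = refl
  ∑ℚ-cong (x ∷ xs) f≡g = cong₂ _+_ (f≡g x) (∑ℚ-cong xs f≡g)

  -- A vertex is penalised by a factor g whenever its expected degree is at least 2.
  -- Each penalty multiplies P = ∑_T g^cost by at most about 1 - 2(1 - g), whereas a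
  -- cheap tree always keeps P above g^((2 - 1/N) · number of penalties); these
  -- bounds cross after boundedly many penalties.
  module MultiplicativeWeights
    {A : Set} (trees : List A) {n} (deg : Fin n → A → ℕ) (m : ℕ) (deg≤m : ∀ v T → deg v T ℕ.≤ m)
    (N J : ℕ) (1+J≡2N : suc J ≡ N ℕ.+ N)
    where

    cost : List (Fin n) → A → ℕ
    cost h T = sum (map (λ v → deg v T) h)

    private
      -- `c` bounds the square of `ι (N * d)` for every degree `d ≤ m`. Taking `M = 2 * (1 + c)` and
      -- `η = 1/M` keeps the quadratic error `c * (η * η)` within `½ * η`.
      c = ι (N ℕ.* m) * ι (N ℕ.* m)

      M = 2 ℕ.* suc (N ℕ.* m ℕ.* (N ℕ.* m))

      ιM≡ : ι M ≡ (1ℚ + 1ℚ) * (1ℚ + c)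
      ιM≡ = trans (×1-homo-* 2 (suc (N ℕ.* m ℕ.* (N ℕ.* m))))
        (cong₂ _*_ (cong (λ x → 1ℚ + x) (ℚ.+-identityʳ 1ℚ)) (cong (λ x → 1ℚ + x) (×1-homo-* (N ℕ.* m) (N ℕ.* m))))

      0<ιM : 0ℚ < ι M
      0<ιM = 0<ι-suc (N ℕ.* m ℕ.* (N ℕ.* m) ℕ.+ 1 ℕ.* suc (N ℕ.* m ℕ.* (N ℕ.* m)))

      η = proj₁ (reciprocal (ι M) 0<ιM)

      ιMη : ι M * η ≡ 1ℚ
      ιMη = proj₂ (proj₂ (reciprocal (ι M) 0<ιM))

      0<η : 0ℚ < η
      0<η = proj₁ (proj₂ (reciprocal (ι M) 0<ιM))

      0≤η : 0ℚ ≤ η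
      0≤η = ℚ.<⇒≤ 0<η

      0≤½η : 0ℚ ≤ ½ * η
      0≤½η = *-nonNeg (ℚ.<⇒≤ 0<½) 0≤η

      0≤c : 0ℚ ≤ c
      0≤c = *-nonNeg (0≤ι (N ℕ.* m)) (0≤ι (N ℕ.* m))

      η+cη : η + c * η ≡ ½
      η+cη = trans (solve 2 (λ c η → η :+ c :* η := con ½ :* (((con 1ℚ :+ con 1ℚ) :* (con 1ℚ :+ c)) :* η)) refl c η)
        (trans (cong (λ x → ½ * (x * η)) (sym ιM≡)) (trans (cong (½ *_) ιMη) (ℚ.*-identityʳ ½)))

      η<1 : η < 1ℚ
      η<1 = ℚ.≤-<-trans (subst (η ≤_) η+cη (p≤p+q (*-nonNeg 0≤c 0≤η))) (from-yes (½ ℚ.<? 1ℚ))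

      cη≤½ : c * η ≤ ½
      cη≤½ = ≤-by η 0≤η (trans (sym η+cη) (ℚ.+-comm η (c * η)))

      g₀ = 1ℚ - η

      0<g₀ : 0ℚ < g₀
      0<g₀ = subst (_< g₀) (ℚ.+-inverseʳ η) (ℚ.+-monoˡ-< (ℚ.- η) η<1)

      g₀≤1 : g₀ ≤ 1ℚ
      g₀≤1 = ≤-by η 0≤η (solve 1 (λ η → con 1ℚ := con 1ℚ :- η :+ η) refl η)

    -- An `N`-th power clears the denominator of the rate `J/N = 2 - 1/N`: bounds on `N * cost`
    -- against `J * length` become comparisons of exponents of `g₀`.
    g : ℚ
    g = g₀ ^ N

    0<g : 0ℚ < g
    0<g = ^-pos 0<g₀ N

    W : List (Fin n) → A → ℚ
    W h T = g ^ cost h T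

    P : List (Fin n) → ℚ
    P h = ∑ℚ trees (W h)

    -- Expected degree below 2 for the distribution proportional to `W h`, multiplied through by the
    -- normalising sum `P h`.
    Balanced : List (Fin n) → Fin n → Set
    Balanced h v = ∑ℚ trees (λ T → W h T * ι (deg v T)) < (1ℚ + 1ℚ) * P h

    private
      -- Penalising an unbalanced vertex multiplies `P` by at most `α` (`P-step-α`), while a cheap
      -- tree guarantees a factor `β` per penalty (`P-lower`). The gap between them is measured by
      -- `α * 1+½η ≤ β`.
      β α 1+½η : ℚ
      β = g₀ ^ J
      α = (1ℚ + ½ * η) - (1ℚ + 1ℚ) * (ι N * η)
      1+½η = 1ℚ + ½ * η

      0≤W : ∀ h T → 0ℚ ≤ W h T
      0≤W h T = ℚ.<⇒≤ (^-pos 0<g (cost h T))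

      g^d≤ : ∀ d → d ℕ.≤ m → g ^ d ≤ 1+½η - (ι N * η) * ι d
      g^d≤ d d≤m = Qr.begin
        (g₀ ^ N) ^ d
          Qr.≡⟨ ^-assocʳ g₀ N d ⟩
        g₀ ^ (N ℕ.* d)
          Qr.≤⟨ 1-x^-upper 0≤η (ℚ.<⇒≤ η<1) (N ℕ.* d) ⟩
        1ℚ - Nd * η + (Nd * η) * (Nd * η)
          Qr.≤⟨ ℚ.+-monoʳ-≤ (1ℚ - Nd * η) square ⟩
        1ℚ - Nd * η + ½ * η
          Qr.≡⟨ cong (λ x → 1ℚ - x * η + ½ * η) (×1-homo-* N d) ⟩
        1ℚ - (ι N * ι d) * η + ½ * η
          Qr.≡⟨ solve 3 (λ N d η → con 1ℚ :- (N :* d) :* η :+ con ½ :* η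
                  := con 1ℚ :+ con ½ :* η :- (N :* η) :* d) refl (ι N) (ι d) η ⟩
        1+½η - (ι N * η) * ι d Qr.∎
        where
        Nd = ι (N ℕ.* d)
        Nd≤ : Nd ≤ ι (N ℕ.* m)
        Nd≤ = ι-mono-≤ (ℕ.*-monoʳ-≤ N d≤m)
        square : (Nd * η) * (Nd * η) ≤ ½ * η
        square = Qr.begin
          (Nd * η) * (Nd * η)
            Qr.≡⟨ solve 2 (λ x η → (x :* η) :* (x :* η) := (x :* x) :* (η :* η)) refl Nd η ⟩
          (Nd * Nd) * (η * η)
            Qr.≤⟨ ℚ.*-monoʳ-≤-nonNeg (η * η) {{ℚ.nonNegative (*-nonNeg 0≤η 0≤η)}}
                   (*-mono-≤-nonNeg (0≤ι (N ℕ.* d)) (0≤ι (N ℕ.* m)) Nd≤ Nd≤) ⟩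
          c * (η * η)
            Qr.≡⟨ ℚ.*-assoc c η η ⟨
          (c * η) * η
            Qr.≤⟨ ℚ.*-monoʳ-≤-nonNeg η {{ℚ.nonNegative 0≤η}} cη≤½ ⟩
          ½ * η Qr.∎

      ∑-step : ∀ h v xs → ∑ℚ xs (W (v ∷ h)) ≤
        1+½η * ∑ℚ xs (W h) - (ι N * η) * ∑ℚ xs (λ T → W h T * ι (deg v T))
      ∑-step h v [] = ℚ.≤-reflexive
        (solve 2 (λ a b → con 0ℚ := a :* con 0ℚ :- b :* con 0ℚ) refl 1+½η (ι N * η))
      ∑-step h v (T ∷ xs) = Qr.begin
        g ^ (deg v T ℕ.+ cost h T) + ∑ℚ xs (W (v ∷ h))
          Qr.≤⟨ ℚ.+-mono-≤ term (∑-step h v xs) ⟩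
        (1+½η - (ι N * η) * ι (deg v T)) * W h T + (1+½η * ∑ℚ xs (W h) - (ι N * η) * S)
          Qr.≡⟨ solve 6 (λ a b d w s t → (a :- b :* d) :* w :+ (a :* s :- b :* t)
                 := a :* (w :+ s) :- b :* (w :* d :+ t)) refl
                 1+½η (ι N * η) (ι (deg v T)) (W h T) (∑ℚ xs (W h)) S ⟩
        1+½η * (W h T + ∑ℚ xs (W h)) - (ι N * η) * (W h T * ι (deg v T) + S) Qr.∎
        where
        S = ∑ℚ xs (λ T → W h T * ι (deg v T))
        term : g ^ (deg v T ℕ.+ cost h T) ≤ (1+½η - (ι N * η) * ι (deg v T)) * W h T
        term = subst (_≤ (1+½η - (ι N * η) * ι (deg v T)) * W h T) (sym (^-homo-* g (deg v T) (cost h T)))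
          (ℚ.*-monoʳ-≤-nonNeg (W h T) {{ℚ.nonNegative (0≤W h T)}} (g^d≤ (deg v T) (deg≤m v T)))

      P-step-α : ∀ h v → ¬ Balanced h v → P (v ∷ h) ≤ α * P h
      P-step-α h v ¬b = Qr.begin
        P (v ∷ h)
          Qr.≤⟨ ∑-step h v trees ⟩
        1+½η * P h - (ι N * η) * D
          Qr.≤⟨ ≤-by ((ι N * η) * (D - (1ℚ + 1ℚ) * P h))
                 (*-nonNeg (*-nonNeg (0≤ι N) 0≤η) (0≤q-p (ℚ.≮⇒≥ ¬b)))
                 (solve 4 (λ a b p d → (a :- (con 1ℚ :+ con 1ℚ) :* b) :* p
                    := a :* p :- b :* d :+ b :* (d :- (con 1ℚ :+ con 1ℚ) :* p)) refl
                    1+½η (ι N * η) (P h) D) ⟩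
        α * P h Qr.∎
        where D = ∑ℚ trees (λ T → W h T * ι (deg v T))

      -- `β` is at least `1 - J * η`, and `J = 2N - 1` turns this into `1 + η - 2N * η`. The spare
      -- `η` comes from the saving of `1/N` in the cost of a cheap tree; half of it has been spent
      -- in `α` on the quadratic error.
      α+½η≤β : α + ½ * η ≤ β
      α+½η≤β = subst (_≤ β) eq (1-x^-lower 0≤η (ℚ.<⇒≤ η<1) J)
        where
        eq : 1ℚ - ι J * η ≡ α + ½ * η
        eq = trans
          (solve 2 (λ j η → con 1ℚ :- j :* η := con 1ℚ :+ η :- (con 1ℚ :+ j) :* η) refl (ι J) η)
          (trans (cong (λ x → 1ℚ + η - x * η) (trans (cong ι 1+J≡2N) (×-homo-+ 1ℚ N N)))
            (solve 2 (λ N η → con 1ℚ :+ η :- (N :+ N) :* η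
              := con 1ℚ :+ con ½ :* η :- (con 1ℚ :+ con 1ℚ) :* (N :* η) :+ con ½ :* η) refl (ι N) η))

      α1+½η≤β : α * 1+½η ≤ β
      α1+½η≤β = ℚ.≤-trans (≤-by ((1ℚ - α) * (½ * η)) (*-nonNeg (0≤q-p α≤1) 0≤½η)
          (solve 2 (λ a h → a :+ h := a :* (con 1ℚ :+ h) :+ (con 1ℚ :- a) :* h) refl α (½ * η)))
        α+½η≤β
        where
        α≤1 : α ≤ 1ℚ
        α≤1 = ℚ.≤-trans (p≤p+q 0≤½η) (ℚ.≤-trans α+½η≤β (^-≤1 0<g₀ g₀≤1 J))

      0≤P : ∀ h → 0ℚ ≤ P h
      0≤P h = ∑ℚ-nonNeg trees (0≤W h)

      0<1+½η : 0ℚ < 1+½η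
      0<1+½η = ℚ.<-≤-trans (ℚ.positive⁻¹ 1ℚ) (p≤p+q 0≤½η)

      P-step : ∀ h v → ¬ Balanced h v → P (v ∷ h) * 1+½η ≤ β * P h
      P-step h v ¬b = Qr.begin
        P (v ∷ h) * 1+½η
          Qr.≤⟨ ℚ.*-monoʳ-≤-nonNeg 1+½η {{ℚ.nonNegative (ℚ.<⇒≤ 0<1+½η)}} (P-step-α h v ¬b) ⟩
        α * P h * 1+½η
          Qr.≡⟨ solve 3 (λ a p h → a :* p :* h := a :* h :* p) refl α (P h) 1+½η ⟩
        α * 1+½η * P h
          Qr.≤⟨ ℚ.*-monoʳ-≤-nonNeg (P h) {{ℚ.nonNegative (0≤P h)}} α1+½η≤β ⟩
        β * P h Qr.∎

      t = ι (length trees)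

      -- Invariant of the search. It starts from `P [] = t`, and every penalty adds one factor
      -- `1+½η` of advantage over the power of `β`.
      Bounded : List (Fin n) → Set
      Bounded h = P h * 1+½η ^ length h ≤ t * β ^ length h

      bounded-[] : Bounded []
      bounded-[] = ℚ.≤-reflexive (cong (_* 1ℚ) (∑ℚ-1 trees))

      bounded-∷ : ∀ h v → ¬ Balanced h v → Bounded h → Bounded (v ∷ h)
      bounded-∷ h v ¬b bd = Qr.begin
        P (v ∷ h) * (1+½η * 1+½η ^ length h)
          Qr.≡⟨ ℚ.*-assoc (P (v ∷ h)) 1+½η (1+½η ^ length h) ⟨
        P (v ∷ h) * 1+½η * 1+½η ^ length h
          Qr.≤⟨ ℚ.*-monoʳ-≤-nonNeg (1+½η ^ length h) {{ℚ.nonNegative (ℚ.<⇒≤ (^-pos 0<1+½η (length h)))}} (P-step h v ¬b) ⟩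
        β * P h * 1+½η ^ length h
          Qr.≡⟨ ℚ.*-assoc β (P h) (1+½η ^ length h) ⟩
        β * (P h * 1+½η ^ length h)
          Qr.≤⟨ ℚ.*-monoˡ-≤-nonNeg β {{ℚ.nonNegative (ℚ.<⇒≤ (^-pos 0<g₀ J))}} bd ⟩
        β * (t * β ^ length h)
          Qr.≡⟨ solve 3 (λ b t x → b :* (t :* x) := t :* (b :* x)) refl β t (β ^ length h) ⟩
        t * (β * β ^ length h) Qr.∎

    module _ (cheap : ∀ h → ∃ λ T → T ∈ˡ trees × N ℕ.* cost h T ℕ.≤ J ℕ.* length h) where

      private
        P-lower : ∀ h → β ^ length h ≤ P h
        P-lower h with T , T∈ , le ← cheap h = Qr.begin
          (g₀ ^ J) ^ length h
            Qr.≡⟨ ^-assocʳ g₀ J (length h) ⟩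
          g₀ ^ (J ℕ.* length h)
            Qr.≤⟨ ^-antimono-≤ 0<g₀ g₀≤1 le ⟩
          g₀ ^ (N ℕ.* cost h T)
            Qr.≡⟨ ^-assocʳ g₀ N (cost h T) ⟨
          W h T
            Qr.≤⟨ ∑ℚ-term (0≤W h) T∈ ⟩
          P h Qr.∎

        -- Chosen so that `ι K * (½ * η) = t`, by `ι M * η = 1`. By Bernoulli the accumulated
        -- advantage `1+½η ^ K` is then at least `1 + t`, whereas the invariant and `P-lower` cap it
        -- at `t`.
        K = (M ℕ.+ M) ℕ.* length trees

        absurd : ∀ h → length h ≡ K → ¬ Bounded h
        absurd h h≡K bd = ℚ.<-irrefl refl (ℚ.<-≤-trans t<1+t (Qr.begin
          1ℚ + t
            Qr.≡⟨ cong (λ x → 1ℚ + x) t≡ ⟩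
          1ℚ + ι K * (½ * η)
            Qr.≤⟨ bernoulli 0≤½η K ⟩
          1+½η ^ K
            Qr.≤⟨ ℚ.*-cancelˡ-≤-pos (β ^ K) {{ℚ.positive (^-pos (^-pos 0<g₀ J) K)}} (Qr.begin
              β ^ K * 1+½η ^ K
                Qr.≤⟨ ℚ.*-monoʳ-≤-nonNeg (1+½η ^ K) {{ℚ.nonNegative (ℚ.<⇒≤ (^-pos 0<1+½η K))}}
                        (subst (λ k → β ^ k ≤ P h) h≡K (P-lower h)) ⟩
              P h * 1+½η ^ K
                Qr.≤⟨ subst (λ k → P h * 1+½η ^ k ≤ t * β ^ k) h≡K bd ⟩
              t * β ^ K
                Qr.≡⟨ ℚ.*-comm t (β ^ K) ⟩
              β ^ K * t Qr.∎) ⟩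
          t Qr.∎))
          where
          t<1+t : t < 1ℚ + t
          t<1+t = subst (_< 1ℚ + t) (ℚ.+-identityˡ t) (ℚ.+-monoˡ-< t (ℚ.positive⁻¹ 1ℚ))
          t≡ : t ≡ ι K * (½ * η)
          t≡ = sym (trans (cong (_* (½ * η)) (trans (×1-homo-* (M ℕ.+ M) (length trees)) (cong (_* t) (×-homo-+ 1ℚ M M))))
            (trans (solve 3 (λ M t η → (M :+ M) :* t :* (con ½ :* η) := M :* η :* t) refl (ι M) t η)
              (trans (cong (_* t) ιMη) (ℚ.*-identityˡ t))))

        balanced? : ∀ h v → Dec (Balanced h v)
        balanced? h v = _ ℚ.<? _

        -- `fuel` is the number of penalties left before the length `K`, at which `absurd` refutes
        -- the invariant.
        search : ∀ fuel h → fuel ℕ.+ length h ≡ K → Bounded h → ∃ λ h → ∀ v → Balanced h v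
        search zero h eq bd = contradiction bd (absurd h eq)
        search (suc fuel) h eq bd with all? (balanced? h)
        ... | yes ok = h , ok
        ... | no ¬ok with v , ¬b ← ¬∀⟶∃¬ n (Balanced h) (balanced? h) ¬ok =
          search fuel (v ∷ h) (trans (ℕ.+-suc fuel (length h)) eq) (bounded-∷ h v ¬b bd)

      balance : ∃ λ g → 0ℚ < g × ∃ λ h → ∀ v →
        ∑ℚ trees (λ T → g ^ cost h T * ι (deg v T)) < (1ℚ + 1ℚ) * ∑ℚ trees (λ T → g ^ cost h T)
      balance = g , 0<g , search K [] (ℕ.+-identityʳ K) bounded-[]

  -- Arithmetic linking relative resistances to expected degrees.

  recipℚ-inverse : ∀ q → 0ℚ < q → q * recipℚ q ≡ 1ℚ
  recipℚ-inverse q 0<q with q ℚ.≟ 0ℚ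
  ... | yes q≡0 = contradiction (sym q≡0) (ℚ.<⇒≢ 0<q)
  ... | no  q≢0 = ℚ.*-inverseʳ q {{ℚ.≢-nonZero q≢0}}

  recipℚ-pos : ∀ q → 0ℚ < q → 0ℚ < recipℚ q
  recipℚ-pos q 0<q with q ℚ.≟ 0ℚ
  ... | yes q≡0 = contradiction (sym q≡0) (ℚ.<⇒≢ 0<q)
  ... | no  q≢0 = ℚ.positive⁻¹ _ {{ℚ.1/pos⇒pos q {{ℚ.positive 0<q}}}}

  ∑ℚ-*ʳ : ∀ {A : Set} (xs : List A) f r → ∑ℚ xs (λ x → f x * r) ≡ ∑ℚ xs f * r
  ∑ℚ-*ʳ []       f r = sym (ℚ.*-zeroˡ r)
  ∑ℚ-*ʳ (x ∷ xs) f r = trans (cong (λ s → f x * r + s) (∑ℚ-*ʳ xs f r)) (sym (ℚ.*-distribʳ-+ r (f x) (∑ℚ xs f)))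

  module _ {m} (W : Subset m → ℚ) where

    ∑ℚ-incidence-step : ∀ trees e es →
      ∑ℚ (filter (e ∈?_) trees) W + ∑ℚ trees (λ T → W T * ι (length (filter (_∈? T) es)))
      ≡ ∑ℚ trees (λ T → W T * ι (length (filter (_∈? T) (e ∷ es))))
    ∑ℚ-incidence-step []          e es = refl
    ∑ℚ-incidence-step (T ∷ trees) e es with e ∈? T
    ... | yes _ = trans
      (solve 4 (λ w a k b → w :+ a :+ (w :* k :+ b) := w :* (con 1ℚ :+ k) :+ (a :+ b)) refl
        (W T) (∑ℚ (filter (e ∈?_) trees) W) (ι (length (filter (_∈? T) es)))
        (∑ℚ trees (λ T → W T * ι (length (filter (_∈? T) es)))))
      (cong (λ x → W T * ι (suc (length (filter (_∈? T) es))) + x) (∑ℚ-incidence-step trees e es))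
    ... | no  _ = trans
      (solve 3 (λ a w b → a :+ (w :+ b) := w :+ (a :+ b)) refl
        (∑ℚ (filter (e ∈?_) trees) W) (W T * ι (length (filter (_∈? T) es)))
        (∑ℚ trees (λ T → W T * ι (length (filter (_∈? T) es)))))
      (cong (λ x → W T * ι (length (filter (_∈? T) es)) + x) (∑ℚ-incidence-step trees e es))

    -- Double counting of the pairs of an edge and a tree containing it. When `es` lists the edges
    -- at one vertex, the right side is the expected degree of that vertex before normalisation.
    ∑ℚ-incidence : ∀ trees es → ∑ℚ es (λ e → ∑ℚ (filter (e ∈?_) trees) W)
                              ≡ ∑ℚ trees (λ T → W T * ι (length (filter (_∈? T) es)))
    ∑ℚ-incidence trees [] = sym (zeros trees)
      where
      zeros : ∀ trees → ∑ℚ trees (λ T → W T * 0ℚ) ≡ 0ℚ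
      zeros []          = refl
      zeros (T ∷ trees) = trans (cong₂ _+_ (ℚ.*-zeroʳ (W T)) (zeros trees)) (ℚ.+-identityˡ 0ℚ)
    ∑ℚ-incidence trees (e ∷ es) = trans
      (cong (λ s → ∑ℚ (filter (e ∈?_) trees) W + s) (∑ℚ-incidence trees es)) (∑ℚ-incidence-step trees e es)

  1-half-pos : ∀ S P r → 0ℚ < r → P * r ≡ 1ℚ → S < (1ℚ + 1ℚ) * P → 0ℚ < 1ℚ - ½ * (S * r)
  1-half-pos S P r 0<r Pr≡1 S<2P =
    subst (_< 1ℚ - ½ * (S * r)) (ℚ.+-inverseʳ (½ * (S * r))) (ℚ.+-monoˡ-< (ℚ.- (½ * (S * r))) (Qr.begin-strict
      ½ * (S * r)
        Qr.<⟨ ℚ.*-monoʳ-<-pos ½ {{ℚ.positive 0<½}} (ℚ.*-monoˡ-<-pos r {{ℚ.positive 0<r}} S<2P) ⟩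
      ½ * ((1ℚ + 1ℚ) * P * r)
        Qr.≡⟨ solve 2 (λ p r → con ½ :* ((con 1ℚ :+ con 1ℚ) :* p :* r) := p :* r) refl P r ⟩
      P * r
        Qr.≡⟨ Pr≡1 ⟩
      1ℚ Qr.∎))

open Rational
open import Data.Nat using (_+_; _*_; _≤_; _<_; _⊔_; _⊓_; _≤?_; _<?_)
open import Data.Nat.Solver using (module +-*-Solver)
open +-*-Solver using (solve; _:+_; _:*_; _:=_; con)

module ℕr = ℕ.≤-Reasoning

-- Finite sums of natural numbers and indicators.

∑ℕ : {A : Set} → List A → (A → ℕ) → ℕ
∑ℕ xs f = sum (map f xs)

∑V : ∀ {n} → (Fin n → ℕ) → ℕ
∑V {n} = ∑ℕ (allFin n)

ind : {P : Set} → Dec P → ℕ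
ind (yes _) = 1
ind (no  _) = 0

ind-yes : {P : Set} (P? : Dec P) → P → ind P? ≡ 1
ind-yes (yes _) _ = refl
ind-yes (no ¬p) p = contradiction p ¬p

ind-no : {P : Set} (P? : Dec P) → ¬ P → ind P? ≡ 0
ind-no (yes p) ¬p = contradiction p ¬p
ind-no (no _)  _  = refl

module _ {A : Set} where

  ∑-cong : (xs : List A) {f g : A → ℕ} → (∀ x → f x ≡ g x) → ∑ℕ xs f ≡ ∑ℕ xs g
  ∑-cong xs f≡g = cong sum (map-cong f≡g xs)

  ∑-mono : (xs : List A) {f g : A → ℕ} → (∀ x → f x ≤ g x) → ∑ℕ xs f ≤ ∑ℕ xs g
  ∑-mono []       f≤g = z≤n
  ∑-mono (x ∷ xs) f≤g = ℕ.+-mono-≤ (f≤g x) (∑-mono xs f≤g)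

  ∑-+ : (xs : List A) (f g : A → ℕ) → ∑ℕ xs (λ x → f x + g x) ≡ ∑ℕ xs f + ∑ℕ xs g
  ∑-+ []       f g = refl
  ∑-+ (x ∷ xs) f g = trans (cong (λ s → f x + g x + s) (∑-+ xs f g))
    (solve 4 (λ a b c d → a :+ b :+ (c :+ d) := a :+ c :+ (b :+ d)) refl (f x) (g x) (∑ℕ xs f) (∑ℕ xs g))

  ∑-* : (xs : List A) (c : ℕ) (f : A → ℕ) → ∑ℕ xs (λ x → c * f x) ≡ c * ∑ℕ xs f
  ∑-* []       c f = sym (ℕ.*-zeroʳ c)
  ∑-* (x ∷ xs) c f = trans (cong (λ s → c * f x + s) (∑-* xs c f)) (sym (ℕ.*-distribˡ-+ c (f x) (∑ℕ xs f)))

  ∑-0 : (xs : List A) → ∑ℕ xs (λ _ → 0) ≡ 0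
  ∑-0 []       = refl
  ∑-0 (_ ∷ xs) = ∑-0 xs

  ∑-1 : (xs : List A) → ∑ℕ xs (λ _ → 1) ≡ length xs
  ∑-1 []       = refl
  ∑-1 (_ ∷ xs) = cong suc (∑-1 xs)

  ∑-term : {xs : List A} (f : A → ℕ) → ∀ {x} → x ∈ˡ xs → f x ≤ ∑ℕ xs f
  ∑-term {_ ∷ xs} f (here refl) = ℕ.m≤m+n _ _
  ∑-term {y ∷ xs} f (there x∈)  = ℕ.≤-trans (∑-term f x∈) (ℕ.m≤n+m _ (f y))

  ∑-filter : {P : A → Set} (P? : U.Decidable P) (xs : List A) (f : A → ℕ) →
             ∑ℕ (filter P? xs) f ≡ ∑ℕ xs (λ x → ind (P? x) * f x)
  ∑-filter P? []       f = refl
  ∑-filter P? (x ∷ xs) f with P? x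
  ... | yes _ = cong₂ _+_ (sym (ℕ.+-identityʳ (f x))) (∑-filter P? xs f)
  ... | no  _ = ∑-filter P? xs f

∑-swap : {A B : Set} (xs : List A) (ys : List B) (f : A → B → ℕ) →
         ∑ℕ xs (λ x → ∑ℕ ys (f x)) ≡ ∑ℕ ys (λ y → ∑ℕ xs (λ x → f x y))
∑-swap []       ys f = sym (∑-0 ys)
∑-swap (x ∷ xs) ys f = trans (cong (λ s → ∑ℕ ys (f x) + s) (∑-swap xs ys f)) (sym (∑-+ ys (f x) _))

∑V-suc : ∀ {n} (f : Fin (suc n) → ℕ) → ∑V f ≡ f zero + ∑V (f ∘ suc)
∑V-suc {n} f = cong (λ ys → f zero + sum ys)
  (trans (cong (map f) (sym (map-tabulate (λ x → x) suc))) (sym (map-∘ (allFin n))))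

∑V-δ : ∀ {n} (a : Fin n) (f : Fin n → ℕ) → ∑V (λ v → ind (a ≟ v) * f v) ≡ f a
∑V-δ {suc n} zero f = trans (∑V-suc (λ v → ind (zero ≟ v) * f v))
  (trans (cong₂ _+_ (ℕ.+-identityʳ (f zero)) (∑-0 (allFin n))) (ℕ.+-identityʳ (f zero)))
∑V-δ {suc n} (suc a) f = trans (∑V-suc (λ v → ind (suc a ≟ v) * f v))
  (trans (∑-cong (allFin n) (λ v → cong (_* f (suc v)) (lemma v))) (∑V-δ a (f ∘ suc)))
  where
  lemma : ∀ v → ind (suc a ≟ suc v) ≡ ind (a ≟ v)
  lemma v with a ≟ v
  ... | yes _ = refl
  ... | no  _ = refl

∑V-ind : ∀ {n} (a : Fin n) → ∑V (λ v → ind (a ≟ v)) ≡ 1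
∑V-ind {n} a = trans (∑-cong (allFin n) (λ v → sym (ℕ.*-identityʳ (ind (a ≟ v))))) (∑V-δ a (λ _ → 1))

-- Kruskal's algorithm as a nested family of forests.

module _ {n} (G : Graph n) where
  open Graph G

  private
    E = Edge G
    V = Fin n
    m = length (edges G)

  src dst : E → V
  src e = proj₁ (ends G e)
  dst e = proj₂ (ends G e)

  src<dst : ∀ e → toℕ (src e) < toℕ (dst e)
  src<dst e = proj₁ (proj₂ (∈-filter⁻ _ {xs = cartesianProduct (allFin n) (allFin n)} (∈-lookup {xs = edges G} e)))

  src~dst : ∀ e → src e ~ dst e
  src~dst e = proj₂ (proj₂ (∈-filter⁻ _ {xs = cartesianProduct (allFin n) (allFin n)} (∈-lookup {xs = edges G} e)))

  adjacent⇒edge : ∀ {u v} → u ~ v → ∃ λ e → Joins G e u v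
  adjacent⇒edge {u} {v} u~v with <-cmp u v
  ... | tri≈ _ refl _ = contradiction u~v (~-irrefl u)
  ... | tri< u<v _ _ = index u∈ , inj₁ (sym (lookup-index u∈))
    where u∈ = ∈-filter⁺ _ (∈-cartesianProduct⁺ (∈-allFin u) (∈-allFin v)) (u<v , u~v)
  ... | tri> _ _ v<u = index v∈ , inj₂ (sym (lookup-index v∈))
    where v∈ = ∈-filter⁺ _ (∈-cartesianProduct⁺ (∈-allFin v) (∈-allFin u)) (v<u , ~-sym u~v)

  Joins-sym : ∀ {e u v} → Joins G e u v → Joins G e v u
  Joins-sym (inj₁ p) = inj₂ p
  Joins-sym (inj₂ p) = inj₁ p

  -- Edge sets are multiplicity functions here, so that all counts are sums.
  Adj : (E → ℕ) → V → V → Set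
  Adj t u v = ∃ λ e → 0 < t e × Joins G e u v

  Adj-sym : ∀ {t u v} → Adj t u v → Adj t v u
  Adj-sym (e , 0<te , j) = e , 0<te , Joins-sym j

  module Kruskal (ρ : E → ℕ) where

    -- A union–find state.
    record Forest (r : ℕ) : Set where
      field
        t       : E → ℕ
        rep     : V → V
        idem    : ∀ v → rep (rep v) ≡ rep v
        toRep   : ∀ v → Star (Adj t) v (rep v)
        bounded : ∀ e → 0 < t e → ρ e ≤ r
        -- Acyclicity in numerical form: roots, one per tree of the forest, and edges together
        -- number `n`.
        count   : ∑V (λ v → ind (rep v ≟ v)) + ∑V t ≡ n

    open Forest

    -- Forests only gain edges and merge classes, so an edge stays joined once it has been
    -- processed.
    record _⊑_ {r r′} (F : Forest r) (F′ : Forest r′) : Set where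
      field
        t-mono  : ∀ e → t F e ≤ t F′ e
        coarser : ∀ u v → rep F u ≡ rep F v → rep F′ u ≡ rep F′ v

    open _⊑_

    ⊑-refl : ∀ {r} {F : Forest r} → F ⊑ F
    ⊑-refl = record { t-mono = λ _ → ℕ.≤-refl ; coarser = λ _ _ p → p }

    ⊑-trans : ∀ {r r′ r″} {F : Forest r} {F′ : Forest r′} {F″ : Forest r″} → F ⊑ F′ → F′ ⊑ F″ → F ⊑ F″
    ⊑-trans p q = record
      { t-mono = λ e → ℕ.≤-trans (t-mono p e) (t-mono q e)
      ; coarser = λ u v → coarser q u v ∘ coarser p u v }

    Joined : ∀ {r} → Forest r → E → Set
    Joined F e = rep F (src e) ≡ rep F (dst e)

    discrete : ∀ r → Forest r
    discrete r = record
      { t = λ _ → 0 ; rep = λ v → v ; idem = λ _ → refl ; toRep = λ _ → ε ; bounded = λ _ ()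
      ; count = trans (cong₂ _+_
          (trans (∑-cong (allFin n) (λ v → ind-yes (v ≟ v) refl)) (∑-1 (allFin n)))
          (∑-0 (allFin m)))
          (trans (ℕ.+-identityʳ _) (length-tabulate (λ v → v))) }

    module Merge {r} (F : Forest r) (e : E) (ρe≤r : ρ e ≤ r) (apart : ¬ Joined F e) where

      private
        a = rep F (src e)
        b = rep F (dst e)

      t′ : E → ℕ
      t′ f = t F f + ind (e ≟ f)

      rep′ : V → V
      rep′ v with rep F v ≟ a
      ... | yes _ = b
      ... | no  _ = rep F v

      rep′-yes : ∀ v → rep F v ≡ a → rep′ v ≡ b
      rep′-yes v p with rep F v ≟ a
      ... | yes _ = refl
      ... | no ¬p = contradiction p ¬p

      rep′-no : ∀ v → rep F v ≢ a → rep′ v ≡ rep F v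
      rep′-no v ¬p with rep F v ≟ a
      ... | yes p = contradiction p ¬p
      ... | no _  = refl

      rep′-b : rep′ b ≡ b
      rep′-b = trans (rep′-no b λ p → apart (sym (trans (sym (idem F (dst e))) p))) (idem F (dst e))

      t≤t′ : ∀ f → t F f ≤ t′ f
      t≤t′ f = ℕ.m≤m+n (t F f) _

      star′ : ∀ {u v} → Star (Adj (t F)) u v → Star (Adj t′) u v
      star′ = mapStar λ (f , 0<tf , j) → f , ℕ.<-≤-trans 0<tf (t≤t′ f) , j

      e∈t′ : 0 < t′ e
      e∈t′ = subst (λ i → 0 < t F e + i) (sym (ind-yes (e ≟ e) refl)) (ℕ.m≤n+m 1 (t F e))

      merged : Forest r
      merged = record
        { t = t′ ; rep = rep′ ; idem = idem′ ; toRep = toRep′ ; bounded = bounded′ ; count = count′ }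
        where
        idem′ : ∀ v → rep′ (rep′ v) ≡ rep′ v
        idem′ v with rep F v ≟ a
        ... | yes _ = rep′-b
        ... | no ¬p = trans (rep′-no (rep F v) λ p → ¬p (trans (sym (idem F v)) p)) (idem F v)

        toRep′ : ∀ v → Star (Adj t′) v (rep′ v)
        toRep′ v with rep F v ≟ a
        ... | yes p = star′ (subst (Star _ v) p (toRep F v)) ◅◅
                      star′ (reverse Adj-sym (toRep F (src e))) ◅◅
                      (e , e∈t′ , inj₁ refl) ◅ star′ (toRep F (dst e))
        ... | no  _ = star′ (toRep F v)

        bounded′ : ∀ f → 0 < t′ f → ρ f ≤ r
        bounded′ f 0<t′f with e ≟ f
        ... | yes refl = ρe≤r
        ... | no  _    = bounded F f (subst (0 <_) (ℕ.+-identityʳ (t F f)) 0<t′f)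

        -- Redirecting the class of `a` to `b` makes `a` the only vertex that stops being a root.
        -- This loss pays for the new edge in `count′`.
        fixed : ∀ v → ind (rep′ v ≟ v) + ind (a ≟ v) ≡ ind (rep F v ≟ v)
        fixed v with a ≟ v
        ... | yes refl = trans (cong (_+ 1) (ind-no (rep′ v ≟ v) λ p →
                apart (trans (sym p) (rep′-yes v (idem F (src e))))))
                (sym (ind-yes (rep F v ≟ v) (idem F (src e))))
        ... | no a≢v with rep F v ≟ v
        ...   | yes p = cong (_+ 0) (ind-yes (rep′ v ≟ v) (trans (rep′-no v λ q → a≢v (trans (sym q) p)) p))
        ...   | no ¬p = cong (_+ 0) (ind-no (rep′ v ≟ v) λ q → not-fixed q (rep F v ≟ a))
          where
          not-fixed : rep′ v ≡ v → ¬ Dec (rep F v ≡ a)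
          not-fixed q (yes p) = ¬p (trans (cong (rep F) v≡b) (trans (idem F (dst e)) (sym v≡b)))
            where v≡b = trans (sym q) (rep′-yes v p)
          not-fixed q (no ¬a) = ¬p (trans (sym (rep′-no v ¬a)) q)

        count′ : ∑V (λ v → ind (rep′ v ≟ v)) + ∑V t′ ≡ n
        count′ = begin
          fix′ + ∑V t′                 ≡⟨ cong (λ s → fix′ + s) (∑-+ (allFin m) (t F) (λ f → ind (e ≟ f))) ⟩
          fix′ + (∑V (t F) + ∑V (λ f → ind (e ≟ f))) ≡⟨ cong (λ i → fix′ + (∑V (t F) + i)) (trans (∑V-ind e) (sym (∑V-ind a))) ⟩
          fix′ + (∑V (t F) + δ)        ≡⟨ solve 3 (λ x y z → x :+ (y :+ z) := x :+ z :+ y) refl fix′ (∑V (t F)) δ ⟩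
          fix′ + δ + ∑V (t F)          ≡⟨ cong (_+ ∑V (t F)) (sym (∑-+ (allFin n) (λ v → ind (rep′ v ≟ v)) (λ v → ind (a ≟ v)))) ⟩
          ∑V (λ v → ind (rep′ v ≟ v) + ind (a ≟ v)) + ∑V (t F) ≡⟨ cong (_+ ∑V (t F)) (∑-cong (allFin n) fixed) ⟩
          ∑V (λ v → ind (rep F v ≟ v)) + ∑V (t F) ≡⟨ count F ⟩
          n ∎
          where
          open ≡-Reasoning
          fix′ = ∑V (λ v → ind (rep′ v ≟ v))
          δ = ∑V (λ v → ind (a ≟ v))

      ⊑-merged : F ⊑ merged
      ⊑-merged = record { t-mono = t≤t′ ; coarser = coarser′ }
        where
        coarser′ : ∀ u v → rep F u ≡ rep F v → rep′ u ≡ rep′ v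
        coarser′ u v p with rep F u ≟ a
        ... | yes q = sym (rep′-yes v (trans (sym p) q))
        ... | no ¬q = trans p (sym (rep′-no v λ q → ¬q (trans p q)))

      joined : Joined merged e
      joined = trans (rep′-yes (src e) refl) (sym (trans (rep′-no (dst e) (apart ∘ sym)) refl))

    add : ∀ {r} (F : Forest r) e → Σ (Forest r) λ F′ → F ⊑ F′ × (ρ e ≤ r → Joined F′ e)
    add {r} F e with ρ e ≤? r | rep F (src e) ≟ rep F (dst e)
    ... | no ρe≰r  | _     = F , ⊑-refl , λ ρe≤r → contradiction ρe≤r ρe≰r
    ... | yes _    | yes p = F , ⊑-refl , λ _ → p
    ... | yes ρe≤r | no ¬p = merged , ⊑-merged , λ _ → joined
      where open Merge F e ρe≤r ¬p

    addAll : ∀ {r} (F : Forest r) es →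
             Σ (Forest r) λ F′ → F ⊑ F′ × (∀ {e} → e ∈ˡ es → ρ e ≤ r → Joined F′ e)
    addAll F [] = F , ⊑-refl , λ ()
    addAll F (e ∷ es)
      with F₁ , F⊑F₁ , j ← add F e
      with F₂ , F₁⊑F₂ , js ← addAll F₁ es
      = F₂ , ⊑-trans F⊑F₁ F₁⊑F₂ , λ where
        (here refl) ρe≤r → coarser F₁⊑F₂ _ _ (j ρe≤r)
        (there e∈)  ρe≤r → js e∈ ρe≤r

    weaken : ∀ {r} → Forest r → Forest (suc r)
    weaken F = record
      { t = t F ; rep = rep F ; idem = idem F ; toRep = toRep F ; count = count F
      ; bounded = λ e 0<te → ℕ.m≤n⇒m≤1+n (bounded F e 0<te) }

    -- Rank `suc r` is processed on top of the forest for rank `r`, so the forests are nested, and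
    -- each spans the components of the graph of all edges of rank at most `r`. Ties are broken by
    -- the order of `allFin m`.
    start : ∀ r → Forest r
    forest : ∀ r → Forest r
    start zero    = discrete zero
    start (suc r) = weaken (forest r)
    forest r = proj₁ (addAll (start r) (allFin m))

    forest-joined : ∀ {r} e → ρ e ≤ r → Joined (forest r) e
    forest-joined {r} e = proj₂ (proj₂ (addAll (start r) (allFin m))) (∈-allFin e)

    forest-mono : ∀ {r r′} → r ≤ r′ → ∀ e → t (forest r) e ≤ t (forest r′) e
    forest-mono {r} {r′} r≤r′ e = go (ℕ.≤⇒≤′ r≤r′)
      where
      go : ∀ {r′} → r ℕ.≤′ r′ → t (forest r) e ≤ t (forest r′) e
      go ℕ.≤′-refl = ℕ.≤-refl
      go (ℕ.≤′-step {r′} p) =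
        ℕ.≤-trans (go p) (t-mono (proj₁ (proj₂ (addAll (start (suc r′)) (allFin m)))) e)

    joins-joined : ∀ {r e u v} → Joins G e u v → ρ e ≤ r → rep (forest r) u ≡ rep (forest r) v
    joins-joined {e = e} (inj₁ refl) ρe≤r = forest-joined e ρe≤r
    joins-joined {e = e} (inj₂ refl) ρe≤r = sym (forest-joined e ρe≤r)

    connect : ∀ {r} (F : Forest r) {u v} → rep F u ≡ rep F v → Star (Adj (t F)) u v
    connect F {u} {v} p = toRep F u ◅◅ subst (λ w → Star _ w v) (sym p) (reverse Adj-sym (toRep F v))

-- Kruskal's tree for the lexicographic order, and its degrees above one level.

module _ {n} (G : Graph n) (y : Fin n → ℕ) (M : ℕ) (y≤M : ∀ v → y v ≤ M) where
  open Graph G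

  private
    m = length (edges G)

  -- Lexicographic comparison of (max , min), coded in one number.
  lex : ℕ → ℕ → ℕ
  lex p q = (p ⊔ q) * suc M + (p ⊓ q)

  ρ : Edge G → ℕ
  ρ e = lex (y (src G e)) (y (dst G e))

  open Kruskal G ρ
  open Forest

  -- Minima are at most `M`, hence below the base `suc M`. An edge therefore has rank at most
  -- `threshold s` exactly when both its ends have height at most `s`.
  threshold : ℕ → ℕ
  threshold s = s * suc M + M

  ρ-joins : ∀ {e u v} → Joins G e u v → ρ e ≡ lex (y u) (y v)
  ρ-joins (inj₁ refl) = refl
  ρ-joins {u = u} {v} (inj₂ refl) =
    cong₂ (λ p q → p * suc M + q) (ℕ.⊔-comm (y v) (y u)) (ℕ.⊓-comm (y v) (y u))

  lex≤threshold : ∀ {p q s} → q ≤ M → p ≤ s → q ≤ s → lex p q ≤ threshold s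
  lex≤threshold {p} {q} q≤M p≤s q≤s =
    ℕ.+-mono-≤ (ℕ.*-monoˡ-≤ (suc M) (ℕ.⊔-lub p≤s q≤s)) (ℕ.≤-trans (ℕ.m⊓n≤n p q) q≤M)

  lex≤threshold⁻ : ∀ {p q s} → lex p q ≤ threshold s → p ≤ s × q ≤ s
  lex≤threshold⁻ {p} {q} {s} le = ℕ.m⊔n≤o⇒m≤o p q max≤s , ℕ.m⊔n≤o⇒n≤o p q max≤s
    where
    max≤s : p ⊔ q ≤ s
    max≤s = ℕ.≤-pred (ℕ.*-cancelʳ-< (suc M) (p ⊔ q) (suc s) (ℕr.begin-strict
      (p ⊔ q) * suc M ℕr.≤⟨ ℕ.m≤m+n _ _ ⟩
      lex p q         ℕr.≤⟨ le ⟩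
      s * suc M + M   ℕr.<⟨ ℕ.+-monoʳ-< (s * suc M) (ℕ.n<1+n M) ⟩
      s * suc M + suc M ℕr.≡⟨ ℕ.+-comm (s * suc M) (suc M) ⟩
      suc s * suc M   ℕr.∎))

  -- Hence a vertex with a neighbour of height at most s < p is first linked by
  -- Kruskal to some vertex of height at most s.
  lex-descend : ∀ {p q q′} → q < p → lex p q′ ≤ lex p q → q′ ≤ q
  lex-descend {p} {q} {q′} q<p le with q′ ≤? p
  ... | yes q′≤p = ℕ.+-cancelˡ-≤ (p * suc M) q′ q
        (subst₂ _≤_ (eq q′≤p) (eq (ℕ.<⇒≤ q<p)) le)
    where
    eq : ∀ {q} → q ≤ p → lex p q ≡ p * suc M + q
    eq q≤p = cong₂ (λ a b → a * suc M + b) (ℕ.m≥n⇒m⊔n≡m q≤p) (ℕ.m≥n⇒m⊓n≡n q≤p)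
  ... | no q′≰p = contradiction le (ℕ.<⇒≱ (ℕr.begin-strict
      lex p q            ℕr.≡⟨ cong₂ (λ a b → a * suc M + b) (ℕ.m≥n⇒m⊔n≡m (ℕ.<⇒≤ q<p)) (ℕ.m≥n⇒m⊓n≡n (ℕ.<⇒≤ q<p)) ⟩
      p * suc M + q      ℕr.<⟨ ℕ.+-monoʳ-< (p * suc M) q<p ⟩
      p * suc M + p      ℕr.≤⟨ ℕ.+-mono-≤ (ℕ.*-monoˡ-≤ (suc M) (ℕ.m≤m⊔n p q′)) (ℕ.⊓-glb ℕ.≤-refl (ℕ.<⇒≤ (ℕ.≰⇒> q′≰p))) ⟩
      lex p q′           ℕr.∎))

  ρ≤top : ∀ e → ρ e ≤ threshold M
  ρ≤top e = lex≤threshold (y≤M _) (y≤M _) (y≤M _)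

  tree : Edge G → ℕ
  tree = t (forest (threshold M))

  tree-connected : ConnectedGraph G → ∀ u v → Star (Adj G tree) u v
  tree-connected conn u v = connect (forest (threshold M)) (joined (conn u v))
    where
    joined : ∀ {u v} → Star _~_ u v → rep (forest (threshold M)) u ≡ rep (forest (threshold M)) v
    joined ε = refl
    joined (u~w ◅ p) with e , j ← adjacent⇒edge G u~w = trans (joins-joined j (ρ≤top e)) (joined p)

  -- The root of the given vertex is one of the roots in `count`, which leaves at most `n - 1`
  -- edges.
  tree-size : Fin n → ∑V tree + 1 ≤ n
  tree-size v = subst (∑V tree + 1 ≤_) (trans (ℕ.+-comm (∑V tree) _) (count F))
    (ℕ.+-monoʳ-≤ (∑V tree) (subst (_≤ ∑V (λ v → ind (rep F v ≟ v))) (ind-yes _ (idem F v))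
      (∑-term (λ v → ind (rep F v ≟ v)) (∈-allFin (rep F v)))))
    where F = forest (threshold M)

  module Level (s : ℕ) (s≤M : s ≤ M) where

    hi lo : Fin n → ℕ
    hi v = ind (s <? y v)
    lo v = ind (y v ≤? s)

    -- With `U` the vertices of height at most `s`, this forest has edges only inside `U` and spans
    -- every component of `G[U]`; the vertices above `s` are isolated in it.
    low : Forest (threshold s)
    low = forest (threshold s)

    cross : Edge G → ℕ
    cross e = hi (src G e) * lo (dst G e) + hi (dst G e) * lo (src G e)

    InBoundary : Fin n → Set
    InBoundary w = s < y w × ∃ λ u → y u ≤ s × w ~ u

    inBoundary? : ∀ w → Dec (InBoundary w)
    inBoundary? w = (s <? y w) ×-dec any? λ u → (y u ≤? s) ×-dec (w ~? u)

    low-joined : ∀ {u v} → y u ≤ s → y v ≤ s → u ~ v → rep low u ≡ rep low v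
    low-joined u≤s v≤s u~v with e , j ← adjacent⇒edge G u~v =
      joins-joined j (subst (_≤ threshold s) (sym (ρ-joins j)) (lex≤threshold (y≤M _) u≤s v≤s))

    low≤tree : ∀ e → t low e ≤ tree e
    low≤tree = forest-mono (ℕ.+-monoˡ-≤ M (ℕ.*-monoˡ-≤ (suc M) s≤M))

    -- The forest at the rank of an edge `e₀` from `w` to `u` contains a path from `w` to `u`. The
    -- first edge of that path ranks no higher than `e₀`, so `lex-descend` places its other end no
    -- higher than `u`; and it survives in `tree` by `forest-mono`.
    boundary-edge : ∀ {w} → InBoundary w → ∃ λ e → 0 < tree e × ∃ λ x → Joins G e w x × y x ≤ s
    boundary-edge {w} (s<w , u , u≤s , w~u) with e₀ , j₀ ← adjacent⇒edge G w~u =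
      first (connect (forest (ρ e₀)) (joins-joined j₀ ℕ.≤-refl))
      where
      first : Star (Adj G (t (forest (ρ e₀)))) w u → ∃ λ e → 0 < tree e × ∃ λ x → Joins G e w x × y x ≤ s
      first ε = contradiction w~u (~-irrefl w)
      first (_◅_ {j = x} (e , 0<te , j) _) =
        e , ℕ.<-≤-trans 0<te (forest-mono (ρ≤top e₀) e) , x , j ,
        ℕ.≤-trans (lex-descend (ℕ.≤-<-trans u≤s s<w)
          (subst₂ _≤_ (ρ-joins j) (ρ-joins j₀) (bounded (forest (ρ e₀)) e 0<te))) u≤s

    boundary≤cross : ∑V (λ w → ind (inBoundary? w)) ≤ ∑V (λ e → tree e * cross e)
    boundary≤cross = ℕr.begin
      ∑V (λ w → ind (inBoundary? w))
        ℕr.≤⟨ ∑-mono (allFin n) charge ⟩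
      ∑V (λ w → ∑V (λ e → tree e * share w e))
        ℕr.≡⟨ ∑-swap (allFin n) (allFin m) (λ w e → tree e * share w e) ⟩
      ∑V (λ e → ∑V (λ w → tree e * share w e))
        ℕr.≡⟨ ∑-cong (allFin m) (λ e → trans (∑-* (allFin n) (tree e) (λ w → share w e)) (cong (tree e *_) (total e))) ⟩
      ∑V (λ e → tree e * cross e) ℕr.∎
      where
      -- The credit that `e` gives to `w`: only an edge crossing the level gives any, and only to
      -- its upper end. The credits of one edge thus add up to `cross e`.
      share : Fin n → Edge G → ℕ
      share w e = ind (src G e ≟ w) * (hi (src G e) * lo (dst G e))
                + ind (dst G e ≟ w) * (hi (dst G e) * lo (src G e))

      total : ∀ e → ∑V (λ w → share w e) ≡ cross e
      total e = trans (∑-+ (allFin n) _ _) (cong₂ _+_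
        (∑V-δ (src G e) (λ _ → hi (src G e) * lo (dst G e)))
        (∑V-δ (dst G e) (λ _ → hi (dst G e) * lo (src G e))))

      one : ∀ {w x} → s < y w → y x ≤ s → 1 ≡ ind (w ≟ w) * (hi w * lo x)
      one {w} {x} s<w x≤s = sym (cong₂ _*_ (ind-yes (w ≟ w) refl)
        (cong₂ _*_ (ind-yes (s <? y w) s<w) (ind-yes (y x ≤? s) x≤s)))

      share≥1 : ∀ {w x} e → s < y w → y x ≤ s → Joins G e w x → 1 ≤ share w e
      share≥1 {w} e s<w x≤s (inj₁ refl) =
        subst (_≤ share w e) (sym (one s<w x≤s)) (ℕ.m≤m+n _ _)
      share≥1 {w} e s<w x≤s (inj₂ refl) =
        subst (_≤ share w e) (sym (one s<w x≤s)) (ℕ.m≤n+m _ _)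

      charge : ∀ w → ind (inBoundary? w) ≤ ∑V (λ e → tree e * share w e)
      charge w = go (inBoundary? w)
        where
        go : (d : Dec (InBoundary w)) → ind d ≤ ∑V (λ e → tree e * share w e)
        go (no _) = z≤n
        go (yes b@(s<w , _)) with e , 0<te , x , j , x≤s ← boundary-edge b =
          ℕ.≤-trans (ℕ.*-mono-≤ 0<te (share≥1 e s<w x≤s j)) (∑-term (λ e → tree e * share w e) (∈-allFin e))

    degrees : Edge G → ℕ
    degrees e = hi (src G e) + hi (dst G e)

    not-low : ∀ e → ¬ (y (src G e) ≤ s × y (dst G e) ≤ s) → t low e ≡ 0
    not-low e ¬p = ℕ.n≤0⇒n≡0 (ℕ.≮⇒≥ λ 0<te → ¬p (lex≤threshold⁻ (bounded low e 0<te)))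

    -- Inside `U` only `low` contributes, and `low` is part of `tree`. A crossing edge has one upper
    -- end and crosses once; an edge above the level has two upper ends. Neither of the last two
    -- kinds occurs in `low`.
    edge-count : ∀ e → tree e * degrees e + 2 * t low e + tree e * cross e ≤ 2 * tree e
    edge-count e with y (src G e) ≤? s | y (dst G e) ≤? s | s <? y (src G e) | s <? y (dst G e)
    ... | yes p | _     | yes q | _     = contradiction q (ℕ.≤⇒≯ p)
    ... | no p  | _     | no q  | _     = contradiction (ℕ.≰⇒> p) q
    ... | _     | yes p | _     | yes q = contradiction q (ℕ.≤⇒≯ p)
    ... | _     | no p  | _     | no q  = contradiction (ℕ.≰⇒> p) q
    ... | yes _ | yes _ | no _  | no _  = ℕr.begin
      tree e * 0 + 2 * t low e + tree e * 0
        ℕr.≡⟨ solve 2 (λ a b → a :* con 0 :+ con 2 :* b :+ a :* con 0 := con 2 :* b) refl (tree e) (t low e) ⟩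
      2 * t low e ℕr.≤⟨ ℕ.*-monoʳ-≤ 2 (low≤tree e) ⟩
      2 * tree e ℕr.∎
    ... | yes _ | no p  | no _  | yes _ = ℕ.≤-reflexive (trans
      (cong (λ x → tree e * 1 + 2 * x + tree e * 1) (not-low e (p ∘ proj₂)))
      (solve 1 (λ a → a :* con 1 :+ con 2 :* con 0 :+ a :* con 1 := con 2 :* a) refl (tree e)))
    ... | no p  | yes _ | yes _ | no _  = ℕ.≤-reflexive (trans
      (cong (λ x → tree e * 1 + 2 * x + tree e * 1) (not-low e (p ∘ proj₁)))
      (solve 1 (λ a → a :* con 1 :+ con 2 :* con 0 :+ a :* con 1 := con 2 :* a) refl (tree e)))
    ... | no p  | no _  | yes _ | yes _ = ℕ.≤-reflexive (trans
      (cong (λ x → tree e * 2 + 2 * x + tree e * 0) (not-low e (p ∘ proj₁)))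
      (solve 1 (λ a → a :* con 2 :+ con 2 :* con 0 :+ a :* con 0 := con 2 :* a) refl (tree e)))

    lowRoots : ℕ
    lowRoots = ∑V (λ v → ind (rep low v ≟ v) * lo v)

    fix≤ : ∑V (λ v → ind (rep low v ≟ v)) ≤ ∑V hi + lowRoots
    fix≤ = subst (∑V (λ v → ind (rep low v ≟ v)) ≤_) (∑-+ (allFin n) hi _) (∑-mono (allFin n) pointwise)
      where
      pointwise : ∀ v → ind (rep low v ≟ v) ≤ hi v + ind (rep low v ≟ v) * lo v
      pointwise v with rep low v ≟ v | s <? y v | y v ≤? s
      ... | no _  | _     | _     = z≤n
      ... | yes _ | yes _ | _     = s≤s z≤n
      ... | yes _ | no _  | yes _ = s≤s z≤n
      ... | yes _ | no q  | no p  = contradiction (ℕ.≰⇒> p) q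

    -- From `D + 2L + X ≤ 2S`, `S + 1 ≤ n`, `fix + L = n` and `fix ≤ H + lowRoots` follows
    -- `D + 2 + X ≤ 2H + 2 lowRoots`. Then `few` and `boundary≤cross` absorb `X` and leave a surplus
    -- of 1. Cancelling a common summand replaces the subtractions.
    level-bound : Fin n → 2 * lowRoots ≤ 1 + ∑V (λ w → ind (inBoundary? w)) →
                  ∑V (λ e → tree e * degrees e) + 1 ≤ 2 * ∑V hi
    level-bound v₀ few = ℕ.+-cancelʳ-≤ (1 + X + (2 * n + (2 * L + 2 * S))) (D + 1) (2 * H) (ℕr.begin
      D + 1 + (1 + X + (2 * n + (2 * L + 2 * S)))
        ℕr.≡⟨ solve 5 (λ D X n L S → D :+ con 1 :+ (con 1 :+ X :+ (con 2 :* n :+ (con 2 :* L :+ con 2 :* S)))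
               := (D :+ con 2 :* L :+ X) :+ con 2 :* n :+ con 2 :* (S :+ con 1)) refl D X n L S ⟩
      (D + 2 * L + X) + 2 * n + 2 * (S + 1)
        ℕr.≤⟨ ℕ.+-mono-≤ (ℕ.+-mono-≤ edges≤ (ℕ.≤-reflexive (cong (2 *_) (sym (count low))))) (ℕ.*-monoʳ-≤ 2 (tree-size v₀)) ⟩
      2 * S + 2 * (fix + L) + 2 * n
        ℕr.≤⟨ ℕ.+-monoˡ-≤ (2 * n) (ℕ.+-monoʳ-≤ (2 * S) (ℕ.*-monoʳ-≤ 2 (ℕ.+-monoˡ-≤ L fix≤))) ⟩
      2 * S + 2 * (H + lowRoots + L) + 2 * n
        ℕr.≡⟨ solve 5 (λ S H R L n → con 2 :* S :+ con 2 :* (H :+ R :+ L) :+ con 2 :* n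
               := con 2 :* H :+ (con 2 :* R :+ (con 2 :* n :+ (con 2 :* L :+ con 2 :* S)))) refl S H lowRoots L n ⟩
      2 * H + (2 * lowRoots + (2 * n + (2 * L + 2 * S)))
        ℕr.≤⟨ ℕ.+-monoʳ-≤ (2 * H) (ℕ.+-monoˡ-≤ (2 * n + (2 * L + 2 * S)) (ℕ.≤-trans few (s≤s boundary≤cross))) ⟩
      2 * H + (1 + X + (2 * n + (2 * L + 2 * S))) ℕr.∎)
      where
      D = ∑V (λ e → tree e * degrees e)
      X = ∑V (λ e → tree e * cross e)
      L = ∑V (t low)
      S = ∑V tree
      H = ∑V hi
      fix = ∑V (λ v → ind (rep low v ≟ v))
      edges≤ : D + 2 * L + X ≤ 2 * S
      edges≤ = ℕr.begin
        D + 2 * L + X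
          ℕr.≡⟨ cong (λ l → D + l + X) (sym (∑-* (allFin m) 2 (t low))) ⟩
        D + ∑V (λ e → 2 * t low e) + X
          ℕr.≡⟨ cong (_+ X) (sym (∑-+ (allFin m) _ _)) ⟩
        ∑V (λ e → tree e * degrees e + 2 * t low e) + X
          ℕr.≡⟨ sym (∑-+ (allFin m) _ _) ⟩
        ∑V (λ e → tree e * degrees e + 2 * t low e + tree e * cross e)
          ℕr.≤⟨ ∑-mono (allFin m) edge-count ⟩
        ∑V (λ e → 2 * tree e)
          ℕr.≡⟨ ∑-* (allFin m) 2 tree ⟩
        2 * S ℕr.∎

-- Toughness, separated vertices and the boundary of a level.

∈-tabulate⁺ : ∀ {n} {P : Fin n → Set} (P? : U.Decidable P) {v} → P v → v ∈ tabulate (does ∘ P?)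
∈-tabulate⁺ P? {v} p = VecP.lookup⇒[]= v _ (trans (VecP.lookup∘tabulate (does ∘ P?) v) (dec-true (P? v) p))

∈-tabulate⁻ : ∀ {n} {P : Fin n → Set} (P? : U.Decidable P) {v} → v ∈ tabulate (does ∘ P?) → P v
∈-tabulate⁻ P? {v} v∈ with P? v | trans (sym (VecP.lookup∘tabulate (does ∘ P?) v)) (VecP.[]=⇒lookup v∈)
... | yes p | _ = p

∣tabulate∣ : ∀ {n} {P : Fin n → Set} (P? : U.Decidable P) → ∣ tabulate (does ∘ P?) ∣ ≡ ∑V (λ v → ind (P? v))
∣tabulate∣ {zero}  P? = refl
∣tabulate∣ {suc n} P? = trans (lemma (P? zero)) (sym (∑V-suc (λ v → ind (P? v))))
  where
  lemma : ∀ {Q : Set} (d : Dec Q) → ∣ does d Vec.∷ tabulate (does ∘ P? ∘ suc) ∣ ≡ ind d + ∑V (λ v → ind (P? (suc v)))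
  lemma (yes _) = cong suc (∣tabulate∣ (P? ∘ suc))
  lemma (no  _) = ∣tabulate∣ (P? ∘ suc)

∑V-unique≤1 : ∀ {n} {P : Fin n → Set} (P? : U.Decidable P) → (∀ {u v} → P u → P v → u ≡ v) →
              ∑V (λ v → ind (P? v)) ≤ 1
∑V-unique≤1 {n} P? unique with any? P?
... | no ¬∃ = ℕ.≤-trans (ℕ.≤-reflexive (trans
        (∑-cong (allFin n) (λ v → ind-no (P? v) λ p → ¬∃ (v , p))) (∑-0 (allFin n)))) z≤n
... | yes (u , p) = subst (∑V (λ v → ind (P? v)) ≤_) (∑V-ind u) (∑-mono (allFin n) λ v → lemma (P? v))
  where
  lemma : ∀ {v} (d : Dec _) → ind d ≤ ind (u ≟ v)
  lemma (no _)  = z≤n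
  lemma {v} (yes q) = ℕ.≤-reflexive (sym (ind-yes (u ≟ v) (unique p q)))

module _ {n} (G : Graph n) where
  open Graph G

  tough⇒ratio : ∀ {t} → Tough t G → ∀ S → [ t ]⁺ ≤⁺ ratio G S
  tough⇒ratio {t} tough S = go (subsets n) tough (subsets-complete S)
    where
    open Min ℚ⁺-totalOrder using (minOperator) renaming (_⊓_ to _⊓⁺_)
    open MinOp minOperator using (x≤y⊓z⇒x≤y; x≤y⊓z⇒x≤z)
    least : List (Subset n) → _
    least Ss = foldr _⊓⁺_ ⊤⁺ (map (ratio G) Ss)
    go : ∀ Ss → [ t ]⁺ ≤⁺ least Ss → S ∈ˡ Ss → [ t ]⁺ ≤⁺ ratio G S
    go (S ∷ Ss) le (here refl) = x≤y⊓z⇒x≤y (ratio G S) (least Ss) le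
    go (S′ ∷ Ss) le (there S∈)  = go Ss (x≤y⊓z⇒x≤z (ratio G S′) (least Ss) le) S∈

  tough⇒size : ∀ {t} → Tough (+ t / 1) G → ∀ S → 1 < numComponents G S → t * numComponents G S ≤ ∣ S ∣
  tough⇒size {t} tough S 1<c = go (tough⇒ratio {+ t / 1} tough S)
    where
    cross-multiply : ∀ a c .{{_ : ℕ.NonZero c}} → (+ t / 1) ℚ.≤ (+ a / c) → t * c ≤ a
    -- The quotients are normalised fractions; passing to unnormalised rationals recovers the
    -- original numerators and denominators.
    cross-multiply a (suc c) le
      with ℚᵘ.*≤* le′ ← ℚᵘ.≤-respˡ-≃ (ℚ.toℚᵘ-fromℚᵘ (mkℚᵘ (+ t) 0))
                        (ℚᵘ.≤-respʳ-≃ (ℚ.toℚᵘ-fromℚᵘ (mkℚᵘ (+ a) c)) (ℚ.toℚᵘ-mono-≤ le))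
      = ℤ.drop‿+≤+ (subst₂ ℤ._≤_ (sym (ℤ.pos-* t (suc c))) (ℤ.*-identityʳ (+ a)) le′)
    go : [ + t / 1 ]⁺ ≤⁺ ratio G S → t * numComponents G S ≤ ∣ S ∣
    go le with 1 <? numComponents G S | le
    ... | yes 1<c | [ le′ ] = cross-multiply ∣ S ∣ (numComponents G S) {{ℕ.>-nonZero (ℕ.<-trans (s≤s z≤n) 1<c)}} le′
    ... | no ¬1<c | _       = contradiction 1<c ¬1<c

  -- Each vertex of `P` is charged to its own component, and separation keeps any component from
  -- being charged twice.
  separated≤components : ∀ S {P : Fin n → Set} (P? : U.Decidable P) → (∀ {v} → P v → v ∉ S) →
    (∀ {u v} → P u → P v → Star (Deleted G S) u v → u ≡ v) →
    ∑V (λ v → ind (P? v)) ≤ numComponents G S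
  separated≤components S {P} P? outside separated = ℕr.begin
    ∑V (λ v → ind (P? v))
      ℕr.≤⟨ ∑-mono (allFin n) (λ v → charge v (P? v)) ⟩
    ∑V (λ v → ∑ℕ comps (λ C → ind (In? C v)))
      ℕr.≡⟨ ∑-swap (allFin n) comps (λ v C → ind (In? C v)) ⟩
    ∑ℕ comps (λ C → ∑V (λ v → ind (In? C v)))
      ℕr.≤⟨ ∑-mono comps (λ C → ∑V-unique≤1 (In? C) unique) ⟩
    ∑ℕ comps (λ _ → 1)
      ℕr.≡⟨ ∑-1 comps ⟩
    length comps ℕr.∎
    where
    comps = components G S
    _≟ˢ_ = VecP.≡-dec _≟ᵇ_

    In : Subset n → Fin n → Set
    In C v = P v × C ≡ component G S v

    In? : ∀ C v → Dec (In C v)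
    In? C v = P? v ×-dec (C ≟ˢ component G S v)

    reach? : ∀ u v → Dec (Star (Deleted G S) u v)
    reach? = star? (deleted? G S)

    unique : ∀ {C u v} → In C u → In C v → u ≡ v
    unique {C} {u} {v} (pu , C≡u) (pv , C≡v) = separated pu pv
      (∈-tabulate⁻ (reach? u) (subst (v ∈_) (trans (sym C≡v) C≡u) (∈-tabulate⁺ (reach? v) ε)))

    charge : ∀ v (d : Dec (P v)) → ind d ≤ ∑ℕ comps (λ C → ind (In? C v))
    charge v (no _)  = z≤n
    charge v (yes p) = subst (_≤ ∑ℕ comps (λ C → ind (In? C v)))
      (ind-yes (In? (component G S v) v) (p , refl))
      (∑-term (λ C → ind (In? C v)) (∈-deduplicate⁺ _≟ˢ_
        (∈-map⁺ (component G S) (∈-filter⁺ (λ v → ¬? (v ∈? S)) (∈-allFin v) (outside p)))))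

module _ {n} (G : Graph n) (conn : ConnectedGraph G) {t} (2≤t : 2 ≤ t) (tough : Tough (+ t / 1) G)
         (y : Fin n → ℕ) (M : ℕ) (y≤M : ∀ v → y v ≤ M) (s : ℕ) (s≤M : s ≤ M) where
  open Graph G
  open Level G y M y≤M s s≤M
  open Kruskal G (ρ G y M y≤M)
  open Forest using (rep)

  boundary : Subset n
  boundary = tabulate (does ∘ inBoundary?)

  ∣boundary∣ : ∣ boundary ∣ ≡ ∑V (λ w → ind (inBoundary? w))
  ∣boundary∣ = ∣tabulate∣ inBoundary?

  private
    Root : Fin n → Set
    Root v = rep low v ≡ v × y v ≤ s

    root? : ∀ v → Dec (Root v)
    root? v = (rep low v ≟ v) ×-dec (y v ≤? s)

    roots : lowRoots ≡ ∑V (λ v → ind (root? v))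
    roots = ∑-cong (allFin n) λ v → lemma (rep low v ≟ v) (y v ≤? s)
      where
      lemma : ∀ {P Q : Set} (p : Dec P) (q : Dec Q) → ind p * ind q ≡ ind (p ×-dec q)
      lemma (yes _) (yes _) = refl
      lemma (yes _) (no  _) = refl
      lemma (no  _) _       = refl

    -- A vertex above `s` with a neighbour in `U` belongs to `boundary`, so walks avoiding
    -- `boundary` cannot leave `U`.
    stays-low : ∀ {u v} → y u ≤ s → Deleted G boundary u v → y v ≤ s
    stays-low {u} {v} u≤s (_ , v∉ , u~v) with y v ≤? s
    ... | yes v≤s = v≤s
    ... | no  v≰s = contradiction (∈-tabulate⁺ inBoundary? (ℕ.≰⇒> v≰s , u , u≤s , ~-sym u~v)) v∉

    same-rep : ∀ {u v} → y u ≤ s → Star (Deleted G boundary) u v → rep low u ≡ rep low v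
    same-rep u≤s ε = refl
    same-rep u≤s (d@(_ , _ , u~w) ◅ p) = trans (low-joined u≤s w≤s u~w) (same-rep w≤s p)
      where w≤s = stays-low u≤s d

    -- `rep low` is constant along walks that start in `U` and avoid `boundary`, so two roots joined
    -- by such a walk coincide.
    roots≤components : lowRoots ≤ numComponents G boundary
    roots≤components = subst (_≤ numComponents G boundary) (sym roots)
      (separated≤components G boundary root?
        (λ (_ , v≤s) v∈ → ℕ.<⇒≱ (proj₁ (∈-tabulate⁻ inBoundary? v∈)) v≤s)
        (λ (ru , u≤s) (rv , _) p → trans (sym ru) (trans (same-rep u≤s p) rv)))

    boundary-nonempty : ∀ {w v} → s < y w → y v ≤ s → Star _~_ w v → ∃ InBoundary
    boundary-nonempty s<w v≤s ε = contradiction v≤s (ℕ.<⇒≱ s<w)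
    boundary-nonempty {w} s<w v≤s (_◅_ {j = x} w~x p) with y x ≤? s
    ... | yes x≤s = w , s<w , x , x≤s , w~x
    ... | no  x≰s = boundary-nonempty (ℕ.≰⇒> x≰s) v≤s p

  -- Toughness speaks only of deletions leaving at least two components, hence the cases. For a
  -- single root the claim is that the boundary is nonempty, which holds because a path leads from
  -- `w`, above `s`, to the root, which is not.
  few-roots : ∀ {w} → s < y w → 2 * lowRoots ≤ 1 + ∑V (λ w → ind (inBoundary? w))
  few-roots {w} s<w with 1 <? lowRoots
  ... | yes 1<c = ℕ.m≤n⇒m≤1+n (subst (2 * lowRoots ≤_) ∣boundary∣ (ℕ.≤-trans
          (ℕ.*-mono-≤ 2≤t roots≤components)
          (tough⇒size G {t} tough boundary (ℕ.<-≤-trans 1<c roots≤components))))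
  ... | no  1≮c with any? root?
  ...   | yes (v , _ , v≤s) = ℕ.≤-trans (ℕ.*-monoʳ-≤ 2 (ℕ.≮⇒≥ 1≮c)) (s≤s nonempty)
    where
    nonempty : 1 ≤ ∑V (λ w → ind (inBoundary? w))
    nonempty with x , x∈ ← boundary-nonempty s<w v≤s (conn w v) =
      subst (_≤ ∑V (λ w → ind (inBoundary? w))) (ind-yes (inBoundary? x) x∈)
        (∑-term (λ w → ind (inBoundary? w)) (∈-allFin x))
  ...   | no ¬root = subst (λ c → 2 * c ≤ 1 + ∑V (λ w → ind (inBoundary? w))) (sym none) z≤n
    where
    none : lowRoots ≡ 0
    none = trans roots (trans (∑-cong (allFin n) λ v → ind-no (root? v) (λ r → ¬root (v , r))) (∑-0 (allFin n)))

-- Summation over all levels.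

∑-levels : ∀ M {k} → k ≤ M → ∑ℕ (downFrom M) (λ s → ind (s <? k)) ≡ k
∑-levels M k≤M = trans (go M) (ℕ.m≥n⇒m⊓n≡n k≤M)
  where
  go : ∀ M {k} → ∑ℕ (downFrom M) (λ s → ind (s <? k)) ≡ M ⊓ k
  go zero    = refl
  go (suc M) {k} with M <? k
  ... | yes M<k = trans (cong suc (trans (go M) (ℕ.m≤n⇒m⊓n≡m (ℕ.<⇒≤ M<k)))) (sym (ℕ.m≤n⇒m⊓n≡m M<k))
  ... | no  M≮k = trans (go M) (trans (ℕ.m≥n⇒m⊓n≡n (ℕ.≮⇒≥ M≮k)) (sym (ℕ.m≥n⇒m⊓n≡n (ℕ.m≤n⇒m≤1+n (ℕ.≮⇒≥ M≮k)))))

module _ {n} (G : Graph n) (conn : ConnectedGraph G) {t} (2≤t : 2 ≤ t) (tough : Tough (+ t / 1) G)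
         (y : Fin n → ℕ) (M : ℕ) (y≤M : ∀ v → y v ≤ M) where

  private
    m = length (edges G)

    T : Edge G → ℕ
    T = tree G y M y≤M

    high : ℕ → Fin n → ℕ
    high s v = ind (s <? y v)

    D H : ℕ → ℕ
    D s = ∑V (λ e → T e * (high s (src G e) + high s (dst G e)))
    H s = ∑V (high s)

    H≤n : ∀ s → H s ≤ n
    H≤n s = subst (H s ≤_) (trans (∑-1 (allFin n)) (length-tabulate (λ v → v)))
      (∑-mono (allFin n) λ v → ind≤1 (s <? y v))
      where
      ind≤1 : ∀ {P : Set} (d : Dec P) → ind d ≤ 1
      ind≤1 (yes _) = ℕ.≤-refl
      ind≤1 (no  _) = z≤n

    -- `level-bound` has a surplus of 1 only when some vertex lies above `s`. Multiplying by `n` and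
    -- using `H s ≤ n` turns it into a surplus of `H s`, which also makes sense on empty levels and
    -- can be summed.
    level : ∀ s → n * D s + H s ≤ (n + n) * H s
    level s with any? (λ v → s <? y v)
    ... | yes (w , s<w) = ℕr.begin
      n * D s + H s ℕr.≤⟨ ℕ.+-monoʳ-≤ (n * D s) (H≤n s) ⟩
      n * D s + n   ℕr.≡⟨ solve 2 (λ n d → n :* d :+ n := n :* (d :+ con 1)) refl n (D s) ⟩
      n * (D s + 1) ℕr.≤⟨ ℕ.*-monoʳ-≤ n (level-bound w (few-roots G conn {t} 2≤t tough y M y≤M s s≤M s<w)) ⟩
      n * (2 * H s) ℕr.≡⟨ solve 2 (λ n h → n :* (con 2 :* h) := (n :+ n) :* h) refl n (H s) ⟩
      (n + n) * H s ℕr.∎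
      where
      s≤M = ℕ.≤-trans (ℕ.<⇒≤ s<w) (y≤M w)
      open Level G y M y≤M s s≤M
    ... | no ¬∃ = ℕ.≤-reflexive (trans (cong₂ _+_ (trans (cong (n *_) D≡0) (ℕ.*-zeroʳ n)) H≡0)
        (sym (trans (cong ((n + n) *_) H≡0) (ℕ.*-zeroʳ (n + n)))))
      where
      high≡0 : ∀ v → high s v ≡ 0
      high≡0 v = ind-no (s <? y v) λ p → ¬∃ (v , p)
      H≡0 : H s ≡ 0
      H≡0 = trans (∑-cong (allFin n) high≡0) (∑-0 (allFin n))
      D≡0 : D s ≡ 0
      D≡0 = trans (∑-cong (allFin m) λ e → trans (cong (T e *_) (cong₂ _+_ (high≡0 _) (high≡0 _))) (ℕ.*-zeroʳ (T e)))
        (∑-0 (allFin m))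

    levels : List ℕ
    levels = downFrom M

    ∑D : ∑ℕ levels D ≡ ∑V (λ e → T e * (y (src G e) + y (dst G e)))
    ∑D = trans (∑-swap levels (allFin m) (λ s e → T e * (high s (src G e) + high s (dst G e))))
      (∑-cong (allFin m) λ e → trans (∑-* levels (T e) (λ s → high s (src G e) + high s (dst G e)))
        (cong (T e *_) (trans (∑-+ levels _ _) (cong₂ _+_ (∑-levels M (y≤M _)) (∑-levels M (y≤M _))))))

    ∑H : ∑ℕ levels H ≡ ∑V y
    ∑H = trans (∑-swap levels (allFin n) high) (∑-cong (allFin n) λ v → ∑-levels M (y≤M v))

  -- A vertex of height `y v` lies above exactly `y v` levels, so summing `level` over `s` turns the
  -- indicators `high s` into `y`.
  tree-cost : n * ∑V (λ e → T e * (y (src G e) + y (dst G e))) + ∑V y ≤ (n + n) * ∑V y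
  tree-cost = subst₂ _≤_
    (trans (∑-+ levels (λ s → n * D s) H) (cong₂ _+_ (trans (∑-* levels n D) (cong (n *_) ∑D)) ∑H))
    (trans (∑-* levels (n + n) H) (cong ((n + n) *_) ∑H))
    (∑-mono levels level)

-- Spanning trees within a connected edge set, and their cost.

connected⇒spanningTree : ∀ {n} (G : Graph n) → ConnectedGraph G → ∃ (IsSpanningTree G)
connected⇒spanningTree G conn = proj₁ T∈ ,
  proj₂ (∈-filter⁻ (isSpanningTree? G) {xs = subsets (length (edges G))} (proj₂ T∈))
  where T∈ = spanningTree-exists G conn

module _ {n} (G : Graph n) where
  open Graph G

  private
    m = length (edges G)

  module _ (t : Edge G → ℕ) (G′ : Graph n) (G′⊆t : ∀ {u v} → Graph._~_ G′ u v → Adj G t u v)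
           (T′ : EdgeSet G′) (tree′ : IsSpanningTree G′ T′) where

    private
      -- `G` and `G′` number their edges independently, so the tree is carried over through the
      -- adjacency of the ends.
      InT : Edge G → Set
      InT e = 0 < t e × Spanned G′ T′ (src G e) (dst G e)

      inT? : ∀ e → Dec (InT e)
      inT? e = (0 <? t e) ×-dec spanned? G′ T′ (src G e) (dst G e)

      T : EdgeSet G
      T = tabulate (does ∘ inT?)

      Spanned-sym : ∀ {u v} → Spanned G′ T′ u v → Spanned G′ T′ v u
      Spanned-sym (e , e∈ , j) = e , e∈ , Joins-sym G′ {e} j

      Spanned⇒Adj : ∀ {u v} → Spanned G′ T′ u v → Adj G t u v
      Spanned⇒Adj (e , _ , inj₁ p) = subst (λ (u , v) → Adj G t u v) p (G′⊆t (src~dst G′ e))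
      Spanned⇒Adj (e , _ , inj₂ p) = Adj-sym G (subst (λ (u , v) → Adj G t u v) p (G′⊆t (src~dst G′ e)))

      to : ∀ {u v} → Spanned G T u v → Spanned G′ T′ u v
      to (e , e∈ , inj₁ p) = subst (λ (u , v) → Spanned G′ T′ u v) p (proj₂ (∈-tabulate⁻ inT? e∈))
      to (e , e∈ , inj₂ p) = Spanned-sym (subst (λ (u , v) → Spanned G′ T′ u v) p (proj₂ (∈-tabulate⁻ inT? e∈)))

      from : ∀ {u v} → Spanned G′ T′ u v → Spanned G T u v
      from s with Spanned⇒Adj s
      ... | e , 0<te , inj₁ p = e , ∈-tabulate⁺ inT? (0<te , subst (λ (u , v) → Spanned G′ T′ u v) (sym p) s) , inj₁ p
      ... | e , 0<te , inj₂ p = e , ∈-tabulate⁺ inT? (0<te , subst (λ (u , v) → Spanned G′ T′ u v) (sym p) (Spanned-sym s)) , inj₂ p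

      IsCycle-map : ∀ {R S : Fin n → Fin n → Set} → (∀ {u v} → R u v → S u v) → ∀ vs → IsCycle R vs → IsCycle S vs
      IsCycle-map f (v ∷ vs) (l , u , c) = l , u , Linked.map f c

    spanningTree-lift : ∃ λ T → IsSpanningTree G T × (∀ e → e ∈ T → 0 < t e)
    spanningTree-lift = T ,
      ((λ u v → mapStar from (proj₁ tree′ u v)) , λ (vs , c) → proj₂ tree′ (vs , IsCycle-map to vs c)) ,
      λ e e∈T → proj₁ (∈-tabulate⁻ inT? e∈T)

  subgraph : (Edge G → ℕ) → Graph n
  subgraph t = record { _~_ = Adj G t ; _~?_ = adj? ; ~-sym = Adj-sym G ; ~-irrefl = adj-irrefl }
    where
    adj? : ∀ u v → Dec (Adj G t u v)
    adj? u v = any? λ e → (0 <? t e) ×-dec (≡-dec _≟_ _≟_ (ends G e) (u , v) ⊎-dec ≡-dec _≟_ _≟_ (ends G e) (v , u))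

    adj-irrefl : ∀ v → ¬ Adj G t v v
    adj-irrefl v (e , _ , j) = ~-irrefl v (loop j)
      where
      loop : Joins G e v v → v ~ v
      loop (inj₁ p) = subst (λ (u , v) → u ~ v) p (src~dst G e)
      loop (inj₂ p) = subst (λ (u , v) → u ~ v) p (src~dst G e)

  -- Turns the connectedness of Kruskal's `tree` into a genuine `IsSpanningTree`. Its edges all have
  -- positive multiplicity in `t`, so the cost can only drop.
  spanningTree-within : ∀ t → (∀ u v → Star (Adj G t) u v) →
                        ∃ λ T → IsSpanningTree G T × (∀ e → e ∈ T → 0 < t e)
  spanningTree-within t conn =
    spanningTree-lift t (subgraph t) (λ a → a) (proj₁ spanning) (proj₂ spanning)
    where spanning = connected⇒spanningTree (subgraph t) conn

  degree : Fin n → EdgeSet G → ℕ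
  degree v T = length (filter (_∈? T) (filter (incident? G v) (allFin m)))

  degree≤m : ∀ v T → degree v T ≤ m
  degree≤m v T = ℕ.≤-trans (length-filter (_∈? T) (filter (incident? G v) (allFin m)))
    (ℕ.≤-trans (length-filter (incident? G v) (allFin m)) (ℕ.≤-reflexive (length-tabulate (λ v → v))))

  exponent : List (Fin n) → Edge G → ℕ
  exponent h e = ∑ℕ h (λ v → ind (incident? G v e))

  multiplicity : List (Fin n) → Fin n → ℕ
  multiplicity h v = ∑ℕ h (λ u → ind (u ≟ v))

  ∑-multiplicity : ∀ h → ∑V (multiplicity h) ≡ length h
  ∑-multiplicity h = trans (∑-swap (allFin n) h (λ v u → ind (u ≟ v)))
    (trans (∑-cong h ∑V-ind) (∑-1 h))

  -- The ends of an edge differ by `src<dst`, so incidence is the sum of two indicators.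
  exponent-multiplicity : ∀ h e → exponent h e ≡ multiplicity h (src G e) + multiplicity h (dst G e)
  exponent-multiplicity h e = trans (∑-cong h pointwise) (∑-+ h _ _)
    where
    pointwise : ∀ v → ind (incident? G v e) ≡ ind (v ≟ src G e) + ind (v ≟ dst G e)
    pointwise v with v ≟ src G e | v ≟ dst G e
    ... | yes refl | yes p = contradiction (cong toℕ p) (ℕ.<⇒≢ (src<dst G e))
    ... | yes refl | no _  = ind-yes (incident? G v e) (inj₁ refl)
    ... | no _  | yes refl = ind-yes (incident? G v e) (inj₂ refl)
    ... | no p  | no q     = ind-no (incident? G v e) λ { (inj₁ r) → p (sym r) ; (inj₂ r) → q (sym r) }

  -- Double counting of incidences between edges of `T` and members of `h`. It identifies the tree
  -- weight, a product over edges, with a power of `g` whose exponent is the cost.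
  ∑-exponent : ∀ h T → ∑ℕ (filter (_∈? T) (allFin m)) (exponent h) ≡ ∑ℕ h (λ v → degree v T)
  ∑-exponent h T = trans (∑-swap (filter (_∈? T) (allFin m)) h (λ e v → ind (incident? G v e)))
    (∑-cong h λ v → begin
      ∑ℕ (filter (_∈? T) (allFin m)) (λ e → ind (incident? G v e))
        ≡⟨ ∑-filter (_∈? T) (allFin m) _ ⟩
      ∑V (λ e → ind (e ∈? T) * ind (incident? G v e))
        ≡⟨ ∑-cong (allFin m) (λ e → solve 2 (λ a b → a :* b := b :* (a :* con 1)) refl (ind (e ∈? T)) (ind (incident? G v e))) ⟩
      ∑V (λ e → ind (incident? G v e) * (ind (e ∈? T) * 1))
        ≡⟨ ∑-filter (incident? G v) (allFin m) _ ⟨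
      ∑ℕ (filter (incident? G v) (allFin m)) (λ e → ind (e ∈? T) * 1)
        ≡⟨ ∑-filter (_∈? T) (filter (incident? G v) (allFin m)) (λ _ → 1) ⟨
      ∑ℕ (filter (_∈? T) (filter (incident? G v) (allFin m))) (λ _ → 1)
        ≡⟨ ∑-1 (filter (_∈? T) (filter (incident? G v) (allFin m))) ⟩
      degree v T ∎)
    where open ≡-Reasoning

  cheap-tree : .{{_ : NonZero n}} → ConnectedGraph G → ∀ {t} → 2 ≤ t → Tough (+ t / 1) G →
    ∀ h → ∃ λ T → T ∈ˡ spanningTrees G × n * ∑ℕ h (λ v → degree v T) ≤ (n + ℕ.pred n) * length h
  cheap-tree conn {t} 2≤t tough h = T , ∈-filter⁺ (isSpanningTree? G) (subsets-complete T) isTree , (ℕr.begin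
    n * ∑ℕ h (λ v → degree v T)
      ℕr.≡⟨ cong (n *_) (sym (∑-exponent h T)) ⟩
    n * ∑ℕ (filter (_∈? T) (allFin m)) (exponent h)
      ℕr.≤⟨ ℕ.*-monoʳ-≤ n (ℕ.≤-trans (ℕ.≤-reflexive (∑-filter (_∈? T) (allFin m) (exponent h)))
             (∑-mono (allFin m) (λ e → lemma e (e ∈? T)))) ⟩
    n * C
      -- Removing one `∑V y` from both sides of `tree-cost` lowers the factor `2n` to `2n - 1`.
      ℕr.≤⟨ ℕ.+-cancelʳ-≤ (∑V y) (n * C) ((n + ℕ.pred n) * ∑V y)
             (ℕ.≤-trans (tree-cost G conn {t} 2≤t tough y M y≤M) (ℕ.≤-reflexive 2n)) ⟩
    (n + ℕ.pred n) * ∑V y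
      ℕr.≡⟨ cong ((n + ℕ.pred n) *_) (∑-multiplicity h) ⟩
    (n + ℕ.pred n) * length h ℕr.∎)
    where
    y = multiplicity h
    M = ∑V y
    y≤M : ∀ v → y v ≤ M
    y≤M v = ∑-term y (∈-allFin v)
    within = spanningTree-within (tree G y M y≤M) (tree-connected G y M y≤M conn)
    T = proj₁ within
    isTree = proj₁ (proj₂ within)
    C = ∑V (λ e → tree G y M y≤M e * (y (src G e) + y (dst G e)))

    2n : (n + n) * ∑V y ≡ (n + ℕ.pred n) * ∑V y + ∑V y
    2n = trans (cong (λ k → (n + k) * ∑V y) (sym (ℕ.suc-pred n)))
      (solve 3 (λ n p s → (n :+ (con 1 :+ p)) :* s := (n :+ p) :* s :+ s) refl n (ℕ.pred n) (∑V y))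

    lemma : ∀ e (d : Dec (e ∈ T)) → ind d * exponent h e ≤ tree G y M y≤M e * (y (src G e) + y (dst G e))
    lemma e (no _)    = z≤n
    lemma e (yes e∈T) = ℕ.*-mono-≤ (proj₂ (proj₂ within) e e∈T) (ℕ.≤-reflexive (exponent-multiplicity h e))

-- Curvature of the constructed weights.

seq-∑ : ∀ {A : Set} (xs : List A) f i → seq (∑ xs f) i ≡ ∑ℚ xs (λ x → seq (f x) i)
seq-∑ []       f i = refl
seq-∑ (x ∷ xs) f i = cong (λ s → seq (f x) i ℚ.+ s) (seq-∑ xs f i)

seq-∏-^ : ∀ {A : Set} (g : ℚ) (xs : List A) f c i → (∀ x → seq (f x) i ≡ g ^ c x) → seq (∏ xs f) i ≡ g ^ ∑ℕ xs c
seq-∏-^ g []       f c i eq = refl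
seq-∏-^ g (x ∷ xs) f c i eq = trans (cong₂ ℚ._*_ (eq x) (seq-∏-^ g xs f c i eq)) (sym (^-homo-* g (c x) (∑ℕ xs c)))

module _ {n} (G : Graph n) (conn : ConnectedGraph G) (g : ℚ) (0<g : 0ℚ ℚ.< g) (h : List (Fin n)) where

  private
    m = length (edges G)

    W : EdgeSet G → ℚ
    W T = g ^ ∑ℕ h (λ v → degree G v T)

    P : ℚ
    P = ∑ℚ (spanningTrees G) W

    S : Fin n → ℚ
    S v = ∑ℚ (spanningTrees G) (λ T → W T ℚ.* ι (degree G v T))

    0<P : 0ℚ ℚ.< P
    0<P = ℚ.<-≤-trans (^-pos 0<g (∑ℕ h (λ v → degree G v T)))
      (∑ℚ-term (λ T → ℚ.<⇒≤ (^-pos 0<g (∑ℕ h (λ v → degree G v T)))) T∈)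
      where
      T = proj₁ (spanningTree-exists G conn)
      T∈ = proj₂ (spanningTree-exists G conn)

  weight : Edge G → ℝ
  weight e = fromℚ (g ^ exponent G h e)

  weight-positive : PositiveWeights G weight
  weight-positive e = g ^ exponent G h e , ^-pos 0<g (exponent G h e) , 0 , λ _ _ → ℚ.≤-refl

  private
    seq-treeWeight : ∀ T i → seq (treeWeight G weight T) i ≡ W T
    seq-treeWeight T i = trans (seq-∏-^ g (filter (_∈? T) (allFin m)) weight (exponent G h) i (λ _ → refl)) (cong (g ^_) (∑-exponent G h T))

    seq-∑-treeWeight : ∀ Ts i → seq (∑ Ts (treeWeight G weight)) i ≡ ∑ℚ Ts W
    seq-∑-treeWeight Ts i = trans (seq-∑ Ts (treeWeight G weight) i) (∑ℚ-cong Ts (λ T → seq-treeWeight T i))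

    -- The weights are constant sequences, so every term of the curvature is the same rational: one
    -- minus half the expected degree `S v * recipℚ P`.
    seq-curvature : ∀ v i → seq (curvature G conn weight weight-positive v) i ≡ 1ℚ ℚ.- ½ ℚ.* (S v ℚ.* recipℚ P)
    seq-curvature v i = cong (λ x → 1ℚ ℚ.- ½ ℚ.* x) (begin
      seq (∑ I (relativeResistance G conn weight weight-positive)) i
        ≡⟨ seq-∑ I (relativeResistance G conn weight weight-positive) i ⟩
      ∑ℚ I (λ e → seq (treeSumThrough G weight e) i ℚ.* recipℚ (seq (treeSum G weight) i))
        ≡⟨ ∑ℚ-cong I (λ e → cong₂ (λ a b → a ℚ.* recipℚ b)
             (seq-∑-treeWeight (filter (e ∈?_) (spanningTrees G)) i) (seq-∑-treeWeight (spanningTrees G) i)) ⟩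
      ∑ℚ I (λ e → ∑ℚ (filter (e ∈?_) (spanningTrees G)) W ℚ.* recipℚ P)
        ≡⟨ ∑ℚ-*ʳ I (λ e → ∑ℚ (filter (e ∈?_) (spanningTrees G)) W) (recipℚ P) ⟩
      ∑ℚ I (λ e → ∑ℚ (filter (e ∈?_) (spanningTrees G)) W) ℚ.* recipℚ P
        ≡⟨ cong (ℚ._* recipℚ P) (∑ℚ-incidence W (spanningTrees G) I) ⟩
      S v ℚ.* recipℚ P ∎)
      where
      open ≡-Reasoning
      I = filter (incident? G v) (allFin m)

  balanced⇒curvature-positive : ∀ v → S v ℚ.< (1ℚ ℚ.+ 1ℚ) ℚ.* P → Positive (curvature G conn weight weight-positive v)
  balanced⇒curvature-positive v balanced =
    1ℚ ℚ.- ½ ℚ.* (S v ℚ.* recipℚ P) ,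
    1-half-pos (S v) P (recipℚ P) (recipℚ-pos P 0<P) (recipℚ-inverse P 0<P) balanced ,
    0 , λ i _ → ℚ.≤-reflexive (sym (seq-curvature v i))

2-tough⇒resistancePositive : ∀ {n} .{{_ : NonZero n}} (G : Graph n) (conn : ConnectedGraph G) →
  ∀ {t} → 2 ≤ t → Tough (+ t / 1) G → ResistancePositive G conn
2-tough⇒resistancePositive {n} G conn {t} 2≤t tough =
  let g , 0<g , h , balanced = MultiplicativeWeights.balance
        (spanningTrees G) (degree G) (length (edges G)) (degree≤m G)
        -- `N = n` and `J = 2n - 1` express the rate `2 - 1/n` achieved by `cheap-tree`.
        n (n + ℕ.pred n) (trans (sym (ℕ.+-suc n (ℕ.pred n))) (cong (λ k → n + k) (ℕ.suc-pred n)))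
        (cheap-tree G conn {t} 2≤t tough)
  in weight G conn g 0<g h , weight-positive G conn g 0<g h , λ v →
     balanced⇒curvature-positive G conn g 0<g h v (balanced v)

corollary5 : ∀ (n : ℕ) .{{_ : NonZero n}} (G : Graph n) (conn : ConnectedGraph G) → Tough (+ 10 / 1) G → ResistancePositive G conn
corollary5 n G conn = 2-tough⇒resistancePositive G conn {10} (s≤s (s≤s z≤n))
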